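{- For $k=1$ and for $k=2$, there is a finite constant $C_k$ such that $f_k(n)=\Theta(C_k^n)$ as $n\to\infty$.
   Context: A permutation $\pi:[n]\to[n]$, where $[n]=\{1,\ldots,n\}$, is $k$-convex (for an integer $k\ge 0$) if $\pi(i-1)+\pi(i+1)-2\pi(i)\le k$ for all $i\in\{2,\ldots,n-1\}$. $f_k(n)$ denotes the number of $k$-convex permutations of length $n$. $f_k(n)=\Theta(C_k^n)$ means that there are constants $c,c'>0$ with $cC_k^n\le f_k(n)\le c'C_k^n$ for all sufficiently large $n$. -}

module Defs where

open import Data.Fin.Base using (Fin; toℕ)
import Data.Fin.Properties as Fin
import Data.Integer.Base as ℤ
import Data.Integer.Properties as ℤ
open import Data.List.Base using (List; []; _∷_; length; filter; allFin; cartesianProductWith)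
open import Data.List.Membership.Propositional using (_∈_)
open import Data.List.Membership.Propositional.Properties
  using (∈-allFin; ∈-cartesianProductWith⁺)
open import Data.List.Relation.Unary.All using ([])
open import Data.List.Relation.Unary.AllPairs using ([]; _∷_)
open import Data.List.Relation.Unary.Any using (here)
open import Data.List.Relation.Unary.Unique.Propositional using (Unique)
open import Data.List.Relation.Unary.Unique.Propositional.Properties
  using (allFin⁺; cartesianProductWith⁺)
open import Data.Nat.Base as ℕ using (ℕ; zero; suc)
import Data.Nat.Properties as ℕ
open import Data.Product.Base using (∃-syntax; _×_; _,_)
open import Data.Rational.Base as ℚ
  using (ℚ; 0ℚ; 1ℚ; _+_; _-_; _*_; _≤_; _<_; ∣_∣; 1/_)
import Data.Rational.Properties as ℚ
open import Data.Rational.Solver using (module +-*-Solver)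
open import Data.Vec.Base using (Vec; []; _∷_; lookup)
import Data.Vec.Properties as Vec
open import Function.Definitions using (Injective; Surjective; Bijective)
open import Relation.Binary.PropositionalEquality
  using (_≡_; refl; sym; trans; cong; subst)
open import Relation.Nullary.Decidable using (Dec; map′; _×-dec_; _→-dec_)

------------------------------------------------------------------------
-- Real numbers, as Cauchy sequences of rationals. No quotient is taken:
-- _≤ℝ_ and _<ℝ_ are insensitive to the choice of representative.

record ℝ : Set where
  constructor mkℝ
  field
    seq    : ℕ → ℚ
    cauchy : ∀ ε → 0ℚ < ε →
             ∃[ N ] ∀ m n → N ℕ.≤ m → N ℕ.≤ n → ∣ seq m - seq n ∣ ≤ ε

open ℝ public

infix 4 _≤ℝ_ _<ℝ_

_≤ℝ_ : ℝ → ℝ → Set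
x ≤ℝ y = ∀ ε → 0ℚ < ε → ∃[ N ] ∀ n → N ℕ.≤ n → seq x n ≤ seq y n + ε

-- The gap ε must be uniform in n: termwise strict inequality would also
-- relate sequences with the same limit.
_<ℝ_ : ℝ → ℝ → Set
x <ℝ y = ∃[ ε ] 0ℚ < ε × (∃[ N ] ∀ n → N ℕ.≤ n → seq x n + ε ≤ seq y n)

fromℚ : ℚ → ℝ
fromℚ q = mkℝ (λ _ → q) λ ε 0<ε → 0 , λ _ _ _ _ →
  subst (λ d → ∣ d ∣ ≤ ε) (sym (ℚ.+-inverseʳ q)) (ℚ.<⇒≤ 0<ε)

fromℕ : ℕ → ℝ
fromℕ n = fromℚ (ℤ.+ n ℚ./ 1)

0ℝ 1ℝ : ℝ
0ℝ = fromℕ 0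
1ℝ = fromℕ 1

private
  0<1 : 0ℚ < 1ℚ
  0<1 = ℚ.positive⁻¹ 1ℚ

  eventuallyBounded : ∀ x → ∃[ B ] 0ℚ < B ×
    (∃[ N ] ∀ n → N ℕ.≤ n → ∣ seq x n ∣ ≤ B)
  eventuallyBounded x with cauchy x 1ℚ 0<1
  ... | N , close = 1ℚ + ∣ seq x N ∣
      , ℚ.+-mono-<-≤ 0<1 (ℚ.0≤∣p∣ (seq x N))
      , N , λ n N≤n → begin
          ∣ seq x n ∣                        ≡⟨ cong ∣_∣ (split (seq x n) (seq x N)) ⟩
          ∣ (seq x n - seq x N) + seq x N ∣  ≤⟨ ℚ.∣p+q∣≤∣p∣+∣q∣ (seq x n - seq x N) (seq x N) ⟩
          ∣ seq x n - seq x N ∣ + ∣ seq x N ∣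
            ≤⟨ ℚ.+-monoˡ-≤ ∣ seq x N ∣ (close n N N≤n ℕ.≤-refl) ⟩
          1ℚ + ∣ seq x N ∣                   ∎
    where
    open ℚ.≤-Reasoning
    open +-*-Solver
    split : ∀ p q → p ≡ (p - q) + q
    split = solve 2 (λ p q → p := (p :- q) :+ q) refl

  *-mono-nonNeg : ∀ {p p′ q q′} → 0ℚ ≤ q → 0ℚ ≤ p′ → p ≤ p′ → q ≤ q′ →
                  p * q ≤ p′ * q′
  *-mono-nonNeg {p} {p′} {q} {q′} 0≤q 0≤p′ p≤p′ q≤q′ = ℚ.≤-trans
    (ℚ.*-monoʳ-≤-nonNeg q {{ℚ.nonNegative 0≤q}} p≤p′)
    (ℚ.*-monoˡ-≤-nonNeg p′ {{ℚ.nonNegative 0≤p′}} q≤q′)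

  expand : ∀ a b c d → a * b - c * d ≡ a * (b - d) + (a - c) * d
  expand = solve 4 (λ a b c d →
    a :* b :- c :* d := a :* (b :- d) :+ (a :- c) :* d) refl
    where open +-*-Solver

  shuffle : ∀ a b e s → a * (e * s) + (e * s) * b ≡ e * (s * (a + b))
  shuffle = solve 4 (λ a b e s →
    a :* (e :* s) :+ (e :* s) :* b := e :* (s :* (a :+ b))) refl
    where open +-*-Solver

  splitError : ∀ A B ε → 0ℚ < A → 0ℚ < B → 0ℚ < ε →
               ∃[ δ ] 0ℚ < δ × A * δ + δ * B ≡ ε
  splitError A B ε 0<A 0<B 0<ε = ε * S⁻¹ , 0<δ ,
    trans (shuffle A B ε S⁻¹)
      (trans (cong (ε *_) (ℚ.*-inverseˡ (A + B) {{nz}})) (ℚ.*-identityʳ ε))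
    where
    pos : ℚ.Positive (A + B)
    pos = ℚ.positive (ℚ.+-mono-< 0<A 0<B)

    nz : ℚ.NonZero (A + B)
    nz = ℚ.pos⇒nonZero (A + B) {{pos}}

    S⁻¹ : ℚ
    S⁻¹ = (1/ (A + B)) {{nz}}

    0<δ : 0ℚ < ε * S⁻¹
    0<δ = ℚ.positive⁻¹ (ε * S⁻¹)
      {{ℚ.pos*pos⇒pos ε {{ℚ.positive 0<ε}} S⁻¹ {{ℚ.1/pos⇒pos (A + B) {{pos}}}}}}

  combine : ∀ {A B δ ε} a b c d → 0ℚ < A → 0ℚ < δ → A * δ + δ * B ≡ ε →
            ∣ a ∣ ≤ A → ∣ d ∣ ≤ B → ∣ a - c ∣ ≤ δ → ∣ b - d ∣ ≤ δ →
            ∣ a * b - c * d ∣ ≤ ε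
  combine {A} {B} {δ} {ε} a b c d 0<A 0<δ total a≤A d≤B a-c≤δ b-d≤δ = begin
    ∣ a * b - c * d ∣                      ≡⟨ cong ∣_∣ (expand a b c d) ⟩
    ∣ a * (b - d) + (a - c) * d ∣          ≤⟨ ℚ.∣p+q∣≤∣p∣+∣q∣ (a * (b - d)) ((a - c) * d) ⟩
    ∣ a * (b - d) ∣ + ∣ (a - c) * d ∣
      ≡⟨ cong (_+ ∣ (a - c) * d ∣) (ℚ.∣p*q∣≡∣p∣*∣q∣ a (b - d)) ⟩
    ∣ a ∣ * ∣ b - d ∣ + ∣ (a - c) * d ∣
      ≡⟨ cong (∣ a ∣ * ∣ b - d ∣ +_) (ℚ.∣p*q∣≡∣p∣*∣q∣ (a - c) d) ⟩
    ∣ a ∣ * ∣ b - d ∣ + ∣ a - c ∣ * ∣ d ∣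
      ≤⟨ ℚ.+-mono-≤
           (*-mono-nonNeg (ℚ.0≤∣p∣ (b - d)) (ℚ.<⇒≤ 0<A) a≤A b-d≤δ)
           (*-mono-nonNeg (ℚ.0≤∣p∣ d) (ℚ.<⇒≤ 0<δ) a-c≤δ d≤B) ⟩
    A * δ + δ * B                          ≡⟨ total ⟩
    ε                                      ∎
    where open ℚ.≤-Reasoning

  *-cauchy : ∀ x y ε → 0ℚ < ε → ∃[ N ] ∀ m n → N ℕ.≤ m → N ℕ.≤ n →
             ∣ seq x m * seq y m - seq x n * seq y n ∣ ≤ ε
  *-cauchy x y ε 0<ε =
    let
      A , 0<A , M₁ , x≤A = eventuallyBounded x
      B , 0<B , M₂ , y≤B = eventuallyBounded y
      δ , 0<δ , total = splitError A B ε 0<A 0<B 0<ε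
      N₁ , x-close = cauchy x δ 0<δ
      N₂ , y-close = cauchy y δ 0<δ
      M = M₁ ℕ.⊔ M₂
      N = N₁ ℕ.⊔ N₂
    in
    M ℕ.⊔ N , λ m n ≤m ≤n →
    let
      N≤m = ℕ.m⊔n≤o⇒n≤o M N ≤m
      N≤n = ℕ.m⊔n≤o⇒n≤o M N ≤n
    in
    combine (seq x m) (seq y m) (seq x n) (seq y n) 0<A 0<δ total
      (x≤A m (ℕ.m⊔n≤o⇒m≤o M₁ M₂ (ℕ.m⊔n≤o⇒m≤o M N ≤m)))
      (y≤B n (ℕ.m⊔n≤o⇒n≤o M₁ M₂ (ℕ.m⊔n≤o⇒m≤o M N ≤n)))
      (x-close m n (ℕ.m⊔n≤o⇒m≤o N₁ N₂ N≤m) (ℕ.m⊔n≤o⇒m≤o N₁ N₂ N≤n))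
      (y-close m n (ℕ.m⊔n≤o⇒n≤o N₁ N₂ N≤m) (ℕ.m⊔n≤o⇒n≤o N₁ N₂ N≤n))

infixl 7 _*ℝ_

_*ℝ_ : ℝ → ℝ → ℝ
x *ℝ y = mkℝ (λ n → seq x n * seq y n) (*-cauchy x y)

infixr 8 _^ℝ_

_^ℝ_ : ℝ → ℕ → ℝ
x ^ℝ zero  = 1ℝ
x ^ℝ suc n = x *ℝ x ^ℝ n

infix 4 _=Θ_

_=Θ_ : (ℕ → ℝ) → (ℕ → ℝ) → Set
u =Θ v = ∃[ c ] ∃[ c′ ] 0ℝ <ℝ c × 0ℝ <ℝ c′ ×
  (∃[ N ] ∀ n → N ℕ.≤ n → (c *ℝ v n ≤ℝ u n) × (u n ≤ℝ c′ *ℝ v n))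

------------------------------------------------------------------------
-- A map π : [n] → [n] is given by the word
-- π(1) … π(n); i : Fin n stands for the element suc (toℕ i) of [n].

IsPermutation : ∀ {n} → Vec (Fin n) n → Set
IsPermutation π = Bijective _≡_ _≡_ (lookup π)

value : ∀ {n} → Vec (Fin n) n → Fin n → ℤ.ℤ
value π i = ℤ.+ suc (toℕ (lookup π i))

-- h, i, j range over the consecutive triples i-1, i, i+1 in [n].
IsConvex : ∀ {n} → ℕ → Vec (Fin n) n → Set
IsConvex {n} k π = ∀ (h i j : Fin n) →
  toℕ i ≡ suc (toℕ h) → toℕ j ≡ suc (toℕ i) →
  value π h ℤ.+ value π j ℤ.- ℤ.+ 2 ℤ.* value π i ℤ.≤ ℤ.+ k

isPermutation? : ∀ {n} (π : Vec (Fin n) n) → Dec (IsPermutation π)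
isPermutation? π = injective? ×-dec surjective?
  where
  injective? : Dec (Injective _≡_ _≡_ (lookup π))
  injective? = map′ (λ f {i} {j} → f i j) (λ f i j → f {i} {j})
    (Fin.all? λ i → Fin.all? λ j →
      (lookup π i Fin.≟ lookup π j) →-dec (i Fin.≟ j))

  surjective? : Dec (Surjective _≡_ _≡_ (lookup π))
  surjective? = Fin.all? λ y → Fin.any? λ x →
    map′ (λ e {z} z≡x → trans (cong (lookup π) z≡x) e) (λ f → f refl)
      (lookup π x Fin.≟ y)

isConvex? : ∀ {n} k (π : Vec (Fin n) n) → Dec (IsConvex k π)
isConvex? k π = Fin.all? λ h → Fin.all? λ i → Fin.all? λ j →
  (toℕ i ℕ.≟ suc (toℕ h)) →-dec (toℕ j ℕ.≟ suc (toℕ i)) →-dec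
  (value π h ℤ.+ value π j ℤ.- ℤ.+ 2 ℤ.* value π i ℤ.≤? ℤ.+ k)

words : ∀ n m → List (Vec (Fin n) m)
words n zero    = [] ∷ []
words n (suc m) = cartesianProductWith _∷_ (allFin n) (words n m)

-- Together with words-unique: words n m lists each word exactly once, so
-- filtering it and taking the length does count words.
words-complete : ∀ {n m} (w : Vec (Fin n) m) → w ∈ words n m
words-complete []      = here refl
words-complete (x ∷ w) = ∈-cartesianProductWith⁺ _∷_ (∈-allFin x) (words-complete w)

words-unique : ∀ n m → Unique (words n m)
words-unique n zero    = [] ∷ []
words-unique n (suc m) =
  cartesianProductWith⁺ _∷_ Vec.∷-injective (allFin⁺ n) (words-unique n m)

f : ℕ → ℕ → ℕ
f k n = length (filter (λ π → isPermutation? π ×-dec isConvex? k π) (words n n))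

{-# OPTIONS --safe #-}

-- For k ≤ 2 no entry of a k-convex permutation is smaller than both neighbours, so the
-- least value sits at one of the two ends. Removing it and iterating encodes the
-- permutations of length n + 1 by words of length n over {L, R}, and k-convexity becomes
-- a condition on these words that only involves, for each letter, the next two
-- occurrences of the same letter.
--
-- Factors of valid words are valid, so the number W(n) of valid words is
-- submultiplicative. For the reverse inequality W(m) W(n) ≤ K W(m+n), valid words u and v
-- can be joined by an alternating word as soon as v may follow LRLR. Let a(n) count
-- the words that may follow LRLR and r(n) those that may follow LL. A word counted by
-- r(n) either continues its run (leaving r(n-1)), or has a single R next (leaving r(n-3)
-- or a(n-3)), or two of them (O(a(n)) cases); on the other hand
-- a(n) ≥ a(n-1) + a(n-3) + a(n-9). As a(n-9) is a positive proportion of a(n), this gives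
-- r = O(a) and then W = O(a).
--
-- Finally the n-th roots of a function that is multiplicative up to a constant factor
-- form a Cauchy sequence, and its limit is the growth rate.
module Submission where

open import Defs
open import Data.Bool.Base using (Bool; true; false; not; _xor_; if_then_else_)
open import Data.Bool.Properties using (not-involutive)
open import Data.Empty using (⊥; ⊥-elim)
open import Data.Fin.Base using (Fin; zero; suc; toℕ; fromℕ<)
open import Data.Fin.Properties using (toℕ-injective; toℕ<n; toℕ-fromℕ<)
import Data.Integer.Base as ℤ
import Data.Integer.Properties as ℤ
open import Data.Integer.Tactic.RingSolver using () renaming (solve-∀ to ℤ-solve-∀)
open import Data.List.Base as List
  using (List; []; _∷_; [_]; _++_; _∷ʳ_; map; length; reverse; filter; tabulate;
         InitLast; initLast; _∷ʳ′_)
open import Data.List.Membership.Propositional using (_∈_)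
open import Data.List.Membership.Propositional.Properties
  using (∈-∃++; ∈-map⁺; ∈-map⁻; ∈-++⁺ˡ; ∈-++⁺ʳ; ∈-++⁻; ∈-filter⁺; ∈-filter⁻;
         ∈-tabulate⁺; ∈-tabulate⁻)
open import Data.List.Properties
  using (map-++; ++-assoc; ++-identityʳ; map-∘; map-id; map-cong; ∷-injectiveˡ;
         ∷-injectiveʳ; ∷ʳ-injectiveˡ; reverse-++; unfold-reverse; reverse-involutive;
         length-++; length-map; length-tabulate; tabulate-cong; tabulate-lookup)
open import Data.List.Relation.Binary.Permutation.Propositional
  using (_↭_; ↭-refl; ↭-sym; ↭-trans; ↭-prep; ↭-reflexive; ↭⇒↭ₛ)
open import Data.List.Relation.Binary.Permutation.Propositional.Properties
  using (∈-resp-↭; ↭-length; shift; drop-mid; ∷↭∷ʳ)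
import Data.List.Relation.Binary.Permutation.Setoid.Properties as ↭ₛ
open import Data.List.Relation.Unary.All as All using ([]; _∷_)
open import Data.List.Relation.Unary.AllPairs using ([]; _∷_)
open import Data.List.Relation.Unary.Any using (here; there)
open import Data.List.Relation.Unary.Unique.Propositional using (Unique)
import Data.List.Relation.Unary.Unique.Propositional.Properties as Unique
open import Data.Nat.Base
open import Data.Nat.Properties
open import Data.Nat.Tactic.RingSolver using (solve-∀)
open import Data.Product.Base using (∃-syntax; _×_; _,_; proj₁; proj₂)
open import Data.Rational.Base as ℚ using (ℚ; mkℚ; 0ℚ)
import Data.Rational.Properties as ℚ
open import Data.Rational.Solver using (module +-*-Solver)
open import Data.Rational.Unnormalised.Base as ℚᵘ using (mkℚᵘ)
import Data.Rational.Unnormalised.Properties as ℚᵘ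
open import Data.Sum.Base using (_⊎_; inj₁; inj₂; [_,_]′)
open import Data.Unit.Base using (⊤; tt)
open import Data.Vec.Base as Vec using (Vec; lookup)
import Data.Vec.Properties as Vec
open import Function.Base using (_∘_)
open import Function.Bundles using (_⇔_; mk⇔; Equivalence)
open import Function.Properties.Equivalence using () renaming (trans to ⇔-trans)
open import Level using (0ℓ)
open import Relation.Binary.PropositionalEquality hiding ([_])
open import Relation.Nullary using (Dec; yes; no; does; contradiction)
open import Relation.Nullary.Decidable using (from-yes; _×-dec_)
open import Relation.Unary using (Pred; Decidable)

open Equivalence using (to; from)

-- Counting words

Word : Set
Word = List Bool

pattern L = false
pattern R = true

count : {P : Pred Word 0ℓ} → Decidable P → ℕ → ℕ
count P? zero    = if does (P? []) then 1 else 0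
count P? (suc n) = count (P? ∘ (L ∷_)) n + count (P? ∘ (R ∷_)) n

private variable
  P Q : Pred Word 0ℓ

count-mono : ∀ (P? : Decidable P) (Q? : Decidable Q) → (∀ w → P w → Q w) →
             ∀ n → count P? n ≤ count Q? n
count-mono P? Q? P⊆Q zero with P? [] | Q? []
... | yes _ | yes _ = ≤-refl
... | yes p | no ¬q = contradiction (P⊆Q [] p) ¬q
... | no _  | _     = z≤n
count-mono P? Q? P⊆Q (suc n) = +-mono-≤
  (count-mono (P? ∘ (L ∷_)) (Q? ∘ (L ∷_)) (P⊆Q ∘ (L ∷_)) n)
  (count-mono (P? ∘ (R ∷_)) (Q? ∘ (R ∷_)) (P⊆Q ∘ (R ∷_)) n)

count-empty : ∀ (P? : Decidable P) → (∀ w → P w → ⊥) → ∀ n → count P? n ≡ 0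
count-empty P? ¬P zero with P? []
... | yes p = contradiction p (¬P [])
... | no _  = refl
count-empty P? ¬P (suc n) = cong₂ _+_
  (count-empty (P? ∘ (L ∷_)) (¬P ∘ (L ∷_)) n)
  (count-empty (P? ∘ (R ∷_)) (¬P ∘ (R ∷_)) n)

-- Exchanging the letters permutes the words of length n; at each letter it swaps the two summands.
count-not : ∀ (P? : Decidable P) n → count (P? ∘ map not) n ≡ count P? n
count-not P? zero    = refl
count-not P? (suc n) = trans (+-comm _ (count (P? ∘ (L ∷_) ∘ map not) n)) (cong₂ _+_
  (count-not (P? ∘ (L ∷_)) n) (count-not (P? ∘ (R ∷_)) n))

-- A word in P extends a prefix in P, and a prefix has at most `2 ^ n` extensions.
count-prefix : ∀ (P? : Decidable P) → (∀ u w → P (u ++ w) → P u) →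
               ∀ m n → count P? (m + n) ≤ count P? m * 2 ^ n
count-prefix P? closed (suc m) n = begin
  count (P? ∘ (L ∷_)) (m + n) + count (P? ∘ (R ∷_)) (m + n)
    ≤⟨ +-mono-≤ (count-prefix (P? ∘ (L ∷_)) (closed ∘ (L ∷_)) m n)
                (count-prefix (P? ∘ (R ∷_)) (closed ∘ (R ∷_)) m n) ⟩
  count (P? ∘ (L ∷_)) m * 2 ^ n + count (P? ∘ (R ∷_)) m * 2 ^ n
    ≡⟨ *-distribʳ-+ (2 ^ n) (count (P? ∘ (L ∷_)) m) _ ⟨
  count P? (suc m) * 2 ^ n ∎
  where open ≤-Reasoning
count-prefix P? closed zero n with P? []
... | no ¬p = ≤-reflexive (count-empty P? (λ w → ¬p ∘ closed [] w) n)
... | yes _ = ≤-trans (bounded P? n) (m≤m+n (2 ^ n) 0)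
  where
  bounded : ∀ {P} (P? : Decidable P) n → count P? n ≤ 2 ^ n
  bounded P? zero with does (P? [])
  ... | true  = ≤-refl
  ... | false = z≤n
  bounded P? (suc n) = +-mono-≤ (bounded (P? ∘ (L ∷_)) n)
    (≤-trans (bounded (P? ∘ (R ∷_)) n) (m≤m+n (2 ^ n) 0))

-- Cutting after m letters maps words injectively to pairs. With validity for both P and Q this
-- becomes submultiplicativity.
count-split : ∀ (P? : Decidable P) (Q? : Decidable Q) →
              (∀ u w → P (u ++ w) → P u × Q w) →
              ∀ m n → count P? (m + n) ≤ count P? m * count Q? n
count-split P? Q? split (suc m) n = begin
  count (P? ∘ (L ∷_)) (m + n) + count (P? ∘ (R ∷_)) (m + n)
    ≤⟨ +-mono-≤ (count-split (P? ∘ (L ∷_)) Q? (split ∘ (L ∷_)) m n)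
                (count-split (P? ∘ (R ∷_)) Q? (split ∘ (R ∷_)) m n) ⟩
  count (P? ∘ (L ∷_)) m * count Q? n + count (P? ∘ (R ∷_)) m * count Q? n
    ≡⟨ *-distribʳ-+ (count Q? n) (count (P? ∘ (L ∷_)) m) _ ⟨
  count P? (suc m) * count Q? n ∎
  where open ≤-Reasoning
count-split P? Q? split zero n with P? []
... | no ¬p = ≤-reflexive (count-empty P? (λ w → ¬p ∘ proj₁ ∘ split [] w) n)
... | yes _ = ≤-trans (count-mono P? Q? (λ w → proj₂ ∘ split [] w) n)
                      (m≤m+n (count Q? n) 0)

-- The lower counterpart of `count-split`: different prefixes have disjoint sets of extensions.
count-join : ∀ (P? : Decidable P) {A l} →
             (∀ u → P u → A ≤ count (P? ∘ (u ++_)) l) →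
             ∀ m → count P? m * A ≤ count P? (m + l)
count-join P? {A} {l} join (suc m) = begin
  count P? (suc m) * A
    ≡⟨ *-distribʳ-+ A (count (P? ∘ (L ∷_)) m) _ ⟩
  count (P? ∘ (L ∷_)) m * A + count (P? ∘ (R ∷_)) m * A
    ≤⟨ +-mono-≤ (count-join (P? ∘ (L ∷_)) (join ∘ (L ∷_)) m)
                (count-join (P? ∘ (R ∷_)) (join ∘ (R ∷_)) m) ⟩
  count (P? ∘ (L ∷_)) (m + l) + count (P? ∘ (R ∷_)) (m + l) ∎
  where open ≤-Reasoning
count-join P? {A} {l} join zero with P? []
... | no _  = z≤n
... | yes p = ≤-trans (≤-reflexive (+-identityʳ A)) (join [] p)

-- Valid words

-- Read relative to a letter b at a value v, with L for the letter b and R for the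
-- other one: the next two b's (the maximum n counting as a b) sit at values x < y,
-- and v + y ≤ k + 2x says that at most k + (x - v - 1) letters R lie between them.
Closes : ℕ → Word → Set
Closes m       []      = ⊤
Closes m       (L ∷ w) = ⊤
Closes zero    (R ∷ w) = ⊥
Closes (suc m) (R ∷ w) = Closes m w

Opens : ℕ → Word → Set
Opens m []      = ⊤
Opens m (L ∷ w) = Closes m w
Opens m (R ∷ w) = Opens (suc m) w

Valid : ℕ → Word → Set
Valid k []      = ⊤
Valid k (b ∷ w) = Opens k (map (b xor_) w) × Valid k w

closes? : ∀ m → Decidable (Closes m)
closes? m       []      = yes tt
closes? m       (L ∷ w) = yes tt
closes? zero    (R ∷ w) = no λ ()
closes? (suc m) (R ∷ w) = closes? m w

opens? : ∀ m → Decidable (Opens m)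
opens? m []      = yes tt
opens? m (L ∷ w) = closes? m w
opens? m (R ∷ w) = opens? (suc m) w

valid? : ∀ k → Decidable (Valid k)
valid? k []      = yes tt
valid? k (b ∷ w) = opens? k (map (b xor_) w) ×-dec valid? k w

closes-suc : ∀ m w → Closes m w → Closes (suc m) w
closes-suc m       []      _ = tt
closes-suc m       (L ∷ w) _ = tt
closes-suc (suc m) (R ∷ w) c = closes-suc m w c

closes-prefix : ∀ m u w → Closes m (u ++ w) → Closes m u
closes-prefix m       []      w _ = tt
closes-prefix m       (L ∷ u) w _ = tt
closes-prefix (suc m) (R ∷ u) w c = closes-prefix m u w c

opens-prefix : ∀ m u w → Opens m (u ++ w) → Opens m u
opens-prefix m []      w _ = tt
opens-prefix m (L ∷ u) w o = closes-prefix m u w o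
opens-prefix m (R ∷ u) w o = opens-prefix (suc m) u w o

valid-prefix : ∀ {k} u w → Valid k (u ++ w) → Valid k u
valid-prefix     []      w _       = tt
valid-prefix {k} (b ∷ u) w (o , v) =
  opens-prefix k (map (b xor_) u) (map (b xor_) w)
    (subst (Opens k) (map-++ (b xor_) u w) o) ,
  valid-prefix u w v

valid-suffix : ∀ {k} u w → Valid k (u ++ w) → Valid k w
valid-suffix []      w v       = v
valid-suffix (b ∷ u) w (_ , v) = valid-suffix u w v

xor-not : ∀ b c → not b xor not c ≡ b xor c
xor-not L c = not-involutive c
xor-not R c = refl

-- Letters enter the conditions only through `b xor c`, which is unchanged when both are negated.
valid-not : ∀ {k} w → Valid k w → Valid k (map not w)
valid-not     []      _       = tt
valid-not {k} (b ∷ w) (o , v) =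
  subst (Opens k) (trans (map-cong (λ c → sym (xor-not b c)) w) (map-∘ w)) o ,
  valid-not w v

-- The word b b̄ b b̄ makes everything before it independent of everything after it.
zigzag : Bool → Word
zigzag b = b ∷ not b ∷ b ∷ not b ∷ []

-- A scan for one L, and in `opens-extend` for two, ends within the zigzag at the latest, so w is
-- never inspected.
closes-extend : ∀ m u b w → Closes m (u ++ zigzag b) → Closes m (u ++ zigzag b ++ w)
closes-extend m             []      L w _ = tt
closes-extend (suc m)       []      R w _ = tt
closes-extend m             (L ∷ u) b w _ = tt
closes-extend (suc m)       (R ∷ u) b w c = closes-extend m u b w c

opens-extend : ∀ m u b w → Opens m (u ++ zigzag b) → Opens m (u ++ zigzag b ++ w)
opens-extend (suc m) []      L w _ = tt
opens-extend m       []      R w _ = tt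
opens-extend m       (L ∷ u) b w o = closes-extend m u b w o
opens-extend m       (R ∷ u) b w o = opens-extend (suc m) u b w o

xor-notʳ : ∀ a b → a xor not b ≡ not (a xor b)
xor-notʳ L b = refl
xor-notʳ R b = refl

map-zigzag : ∀ a b → map (a xor_) (zigzag b) ≡ zigzag (a xor b)
map-zigzag a b rewrite xor-notʳ a b = refl

-- The conditions at the letters of u are settled by the first hypothesis, those at the zigzag and
-- beyond by the second.
valid-overlap : ∀ {k} u b w → Valid k (u ++ zigzag b) → Valid k (zigzag b ++ w) →
                Valid k (u ++ zigzag b ++ w)
valid-overlap     []      b w _       v  = v
valid-overlap {k} (a ∷ u) b w (o , v) v′ =
  subst (Opens k) (sym eq) (opens-extend k (map (a xor_) u) (a xor b) (map (a xor_) w)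
    (subst (Opens k) (trans (map-++ (a xor_) u (zigzag b))
      (cong (map (a xor_) u ++_) (map-zigzag a b))) o)) ,
  valid-overlap u b w v v′
  where
  eq : map (a xor_) (u ++ zigzag b ++ w) ≡
       map (a xor_) u ++ zigzag (a xor b) ++ map (a xor_) w
  eq = trans (map-++ (a xor_) u (zigzag b ++ w))
    (cong (map (a xor_) u ++_) (trans (map-++ (a xor_) (zigzag b) w)
      (cong (_++ map (a xor_) w) (map-zigzag a b))))

turn : Bool → Word → Bool
turn b []      = not b
turn b (c ∷ w) = turn c w

turn-xor : ∀ a b w → a xor turn b w ≡ turn (a xor b) (map (a xor_) w)
turn-xor a b []      = xor-notʳ a b
turn-xor a b (c ∷ w) = turn-xor a c w

-- The zigzag starts with the opposite of the last letter. After a final R it supplies the missing L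
-- at once; after a final L it first adds one R, hence the allowance `suc m` in `closes-turnL`.
closes-turnR : ∀ m w → Closes m w → Closes m (w ++ zigzag (turn R w))
closes-turnL : ∀ m w → Closes (suc m) w → Closes (suc m) (w ++ zigzag (turn L w))

closes-turnR m       []      _ = tt
closes-turnR m       (L ∷ w) _ = tt
closes-turnR (suc m) (R ∷ w) c = closes-turnR m w c

closes-turnL m []      _ = tt
closes-turnL m (L ∷ w) _ = tt
closes-turnL m (R ∷ w) c = closes-turnR m w c

opens-turn : ∀ m b w → Opens (suc m) w → Opens (suc m) (w ++ zigzag (turn b w))
opens-turn m L []      _ = tt
opens-turn m R []      _ = tt
opens-turn m b (L ∷ w) o = closes-turnL m w o
opens-turn m b (R ∷ w) o = opens-turn (suc m) R w o

-- Alternation needs an allowance of just one foreign letter, which a positive parameter provides.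
-- So every nonempty valid word can be led into a zigzag.
valid-turn : ∀ {k} b w → Valid (suc k) (b ∷ w) →
             Valid (suc k) ((b ∷ w) ++ zigzag (turn b w))
valid-turn {k} b w (o , v) =
  subst (Opens (suc k)) (sym eq) (opens-turn k (b xor b) (map (b xor_) w) o) ,
  rest w v
  where
  eq : map (b xor_) (w ++ zigzag (turn b w)) ≡
       map (b xor_) w ++ zigzag (turn (b xor b) (map (b xor_) w))
  eq = trans (map-++ (b xor_) w (zigzag (turn b w)))
    (cong (map (b xor_) w ++_)
      (trans (map-zigzag b (turn b w)) (cong zigzag (turn-xor b b w))))

  rest : ∀ w → Valid (suc k) w → Valid (suc k) (w ++ zigzag (turn b w))
  rest []      _ = zigzag-valid (not b)
    where
    zigzag-valid : ∀ b → Valid (suc k) (zigzag b)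
    zigzag-valid L = tt , tt , tt , tt , tt
    zigzag-valid R = tt , tt , tt , tt , tt
  rest (c ∷ w) v = valid-turn c w v

-- Growth of the number of valid words

infix 9 _[_∣_]

-- Opaque, as comparing counts of length 10 + n would otherwise unfold 2^10 summands.
opaque
  _[_∣_] : ℕ → Word → ℕ → ℕ
  k [ p ∣ n ] = count (valid? k ∘ (p ++_)) n

  [∣]-suc : ∀ k p n → k [ p ∣ suc n ] ≡ k [ p ++ L ∷ [] ∣ n ] + k [ p ++ R ∷ [] ∣ n ]
  [∣]-suc k p n = cong₂ _+_ (≤-antisym (forth L) (back L)) (≤-antisym (forth R) (back R))
    where
    forth : ∀ b → count (valid? k ∘ (p ++_) ∘ (b ∷_)) n ≤ k [ p ++ b ∷ [] ∣ n ]
    forth b = count-mono (valid? k ∘ (p ++_) ∘ (b ∷_)) (valid? k ∘ ((p ++ b ∷ []) ++_))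
      (λ w → subst (Valid k) (sym (++-assoc p (b ∷ []) w))) n

    back : ∀ b → k [ p ++ b ∷ [] ∣ n ] ≤ count (valid? k ∘ (p ++_) ∘ (b ∷_)) n
    back b = count-mono (valid? k ∘ ((p ++ b ∷ []) ++_)) (valid? k ∘ (p ++_) ∘ (b ∷_))
      (λ w → subst (Valid k) (++-assoc p (b ∷ []) w)) n

  [∣]-mono : ∀ {k} p q → (∀ w → Valid k (p ++ w) → Valid k (q ++ w)) →
             ∀ n → k [ p ∣ n ] ≤ k [ q ∣ n ]
  [∣]-mono {k} p q = count-mono (valid? k ∘ (p ++_)) (valid? k ∘ (q ++_))

  [∣]-empty : ∀ {k} p → (∀ w → Valid k (p ++ w) → ⊥) → ∀ n → k [ p ∣ n ] ≡ 0
  [∣]-empty {k} p = count-empty (valid? k ∘ (p ++_))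

  [∣]-zero : ∀ {k} p → Valid k p → k [ p ∣ 0 ] ≡ 1
  [∣]-zero {k} p v with valid? k (p ++ [])
  ... | yes _ = refl
  ... | no ¬v = contradiction (subst (Valid k) (sym (++-identityʳ p)) v) ¬v

  lengthen : ∀ {k} p m n → k [ p ∣ m + n ] ≤ k [ p ∣ m ] * 2 ^ n
  lengthen {k} p = count-prefix (valid? k ∘ (p ++_)) λ u w v →
    valid-prefix (p ++ u) w (subst (Valid k) (sym (++-assoc p u w)) v)

  swap-letters : ∀ {k} p n → k [ map not p ∣ n ] ≤ k [ p ∣ n ]
  swap-letters {k} p n = begin
    k [ map not p ∣ n ]
      ≡⟨ count-not (valid? k ∘ (map not p ++_)) n ⟨
    count (valid? k ∘ (map not p ++_) ∘ map not) n
      ≤⟨ count-mono (valid? k ∘ (map not p ++_) ∘ map not) (valid? k ∘ (p ++_))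
           (λ w v → unflip (p ++ w) (subst (Valid k) (sym (map-++ not p w)) v)) n ⟩
    k [ p ∣ n ] ∎
    where
    open ≤-Reasoning
    unflip : ∀ w → Valid k (map not w) → Valid k w
    unflip w v = subst (Valid k)
      (trans (sym (map-∘ w)) (trans (map-cong not-involutive w) (map-id w)))
      (valid-not (map not w) v)

  [[]]≡count : ∀ k n → k [ [] ∣ n ] ≡ count (valid? k) n
  [[]]≡count k n = refl

  words-submultiplicative : ∀ k m n → k [ [] ∣ m + n ] ≤ k [ [] ∣ m ] * k [ [] ∣ n ]
  words-submultiplicative k = count-split (valid? k) (valid? k)
    λ u w v → valid-prefix u w v , valid-suffix u w v

  words-join : ∀ {k A l} → (∀ u → Valid k u → A ≤ k [ u ∣ l ]) →
               ∀ m → k [ [] ∣ m ] * A ≤ k [ [] ∣ m + l ]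
  words-join {k} = count-join (valid? k)

[∣]-∷ : ∀ {k} p b n → k [ p ++ b ∷ [] ∣ n ] ≤ k [ p ∣ suc n ]
[∣]-∷ {k} p L n = subst (k [ p ++ L ∷ [] ∣ n ] ≤_) (sym ([∣]-suc k p n)) (m≤m+n _ _)
[∣]-∷ {k} p R n = subst (k [ p ++ R ∷ [] ∣ n ] ≤_) (sym ([∣]-suc k p n)) (m≤n+m _ _)

drop-prefix : ∀ {k} u p n → k [ u ++ p ∣ n ] ≤ k [ p ∣ n ]
drop-prefix {k} u p = [∣]-mono (u ++ p) p
  λ w v → valid-suffix u (p ++ w) (subst (Valid k) (++-assoc u p w) v)

extend : ∀ {k} p u n → k [ p ++ u ∣ n ] ≤ k [ p ∣ length u + n ]
extend {k} p []      n = ≤-reflexive (cong (λ q → k [ q ∣ n ]) (++-identityʳ p))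
extend {k} p (b ∷ u) n = begin
  k [ p ++ b ∷ u ∣ n ]
    ≡⟨ cong (λ q → k [ q ∣ n ]) (++-assoc p (b ∷ []) u) ⟨
  k [ (p ++ b ∷ []) ++ u ∣ n ]
    ≤⟨ extend (p ++ b ∷ []) u n ⟩
  k [ p ++ b ∷ [] ∣ length u + n ]
    ≤⟨ [∣]-∷ p b (length u + n) ⟩
  k [ p ∣ suc (length u) + n ] ∎
  where open ≤-Reasoning

-- By `valid-overlap` the zigzag shields u, so whatever may follow the zigzag alone may also follow
-- it after u.
glue : ∀ {k} u b n → Valid k (u ++ zigzag b) →
       k [ zigzag b ∣ n ] ≤ k [ u ++ zigzag b ∣ n ]
glue {k} u b n v = [∣]-mono (zigzag b) (u ++ zigzag b)
  (λ w v′ → subst (Valid k) (sym (++-assoc u (zigzag b) w)) (valid-overlap u b w v v′)) n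

-- `tails`, `runs` and `k [ [] ∣ n ]` are the functions a, r and W of the outline.
tails : ℕ → ℕ → ℕ
tails k n = k [ zigzag L ∣ n ]

tails≤zigzag : ∀ {k} b n → tails k n ≤ k [ zigzag b ∣ n ]
tails≤zigzag L n = ≤-refl
tails≤zigzag R n = swap-letters (zigzag R) n

-- LRLRL is L followed by the zigzag RLRL, and by symmetry RLRL has at least as many continuations
-- as LRLR.
tails-suc : ∀ k n → tails (suc k) n ≤ suc k [ zigzag L ++ L ∷ [] ∣ n ]
tails-suc k n = ≤-trans (tails≤zigzag R n)
  (glue (L ∷ []) R n (tt , tt , tt , tt , tt , tt))

-- The last three letters are those of LRLR, with the same conditions. Of the earlier letters only
-- the third, an L, has a condition that reaches w; two letters R instead of one precede the next L,
-- so one more R is allowed afterwards.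
relax : ∀ k w → Valid (suc k) (zigzag L ++ w) →
        Valid (suc k) ((L ∷ R ∷ L ∷ R ∷ R ∷ L ∷ R ∷ []) ++ w)
relax k w (o₁ , o₂ , o₃ , o₄ , v) =
  tt , tt , closes-suc (suc k) (map (L xor_) w) o₁ , tt , o₂ , o₃ , o₄ , v

relax-count : ∀ k u n → suc k [ zigzag L ++ u ∣ n ] ≤
              suc k [ (L ∷ R ∷ L ∷ R ∷ R ∷ L ∷ R ∷ []) ++ u ∣ n ]
relax-count k u = [∣]-mono (zigzag L ++ u) ((L ∷ R ∷ L ∷ R ∷ R ∷ L ∷ R ∷ []) ++ u)
  (λ w → relax k (u ++ w))

-- After a zigzag one may continue by L, by RLR, or by a further word of length 9.
tails-growth₁ : ∀ n → tails 1 (9 + n) + (tails 1 (7 + n) + tails 1 (1 + n)) ≤ tails 1 (10 + n)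
tails-growth₁ n = begin
  tails 1 (9 + n) + (tails 1 (7 + n) + tails 1 (1 + n))
    ≤⟨ +-mono-≤ (tails-suc 0 (9 + n)) (+-mono-≤ split (glue (p ++ R ∷ R ∷ []) L (1 + n)
         (from-yes (valid? 1 ((p ++ R ∷ R ∷ []) ++ zigzag L))))) ⟩
  1 [ zigzag L ++ L ∷ [] ∣ 9 + n ] +
  ((1 [ p ++ L ∷ [] ∣ 6 + n ] + 1 [ p ++ R ∷ L ∷ [] ∣ 5 + n ])
    + 1 [ (p ++ R ∷ R ∷ []) ++ zigzag L ∣ 1 + n ])
    ≤⟨ +-monoʳ-≤ (1 [ zigzag L ++ L ∷ [] ∣ 9 + n ]) (begin
      (1 [ p ++ L ∷ [] ∣ 6 + n ] + 1 [ p ++ R ∷ L ∷ [] ∣ 5 + n ])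
        + 1 [ (p ++ R ∷ R ∷ []) ++ zigzag L ∣ 1 + n ]
        ≤⟨ +-monoʳ-≤ (1 [ p ++ L ∷ [] ∣ 6 + n ] + 1 [ p ++ R ∷ L ∷ [] ∣ 5 + n ])
             (extend (p ++ R ∷ R ∷ []) (zigzag L) (1 + n)) ⟩
      (1 [ p ++ L ∷ [] ∣ 6 + n ] + 1 [ p ++ R ∷ L ∷ [] ∣ 5 + n ])
        + 1 [ p ++ R ∷ R ∷ [] ∣ 5 + n ]
        ≡⟨ +-assoc (1 [ p ++ L ∷ [] ∣ 6 + n ]) _ _ ⟩
      1 [ p ++ L ∷ [] ∣ 6 + n ] + (1 [ p ++ R ∷ L ∷ [] ∣ 5 + n ] + 1 [ p ++ R ∷ R ∷ [] ∣ 5 + n ])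
        ≡⟨ cong (1 [ p ++ L ∷ [] ∣ 6 + n ] +_) ([∣]-suc 1 (p ++ R ∷ []) (5 + n)) ⟨
      1 [ p ++ L ∷ [] ∣ 6 + n ] + 1 [ p ++ R ∷ [] ∣ 6 + n ]
        ≡⟨ [∣]-suc 1 p (6 + n) ⟨
      1 [ p ∣ 7 + n ]
        ≤⟨ extend (zigzag L ++ R ∷ []) (L ∷ R ∷ []) (7 + n) ⟩
      1 [ zigzag L ++ R ∷ [] ∣ 9 + n ] ∎) ⟩
  1 [ zigzag L ++ L ∷ [] ∣ 9 + n ] + 1 [ zigzag L ++ R ∷ [] ∣ 9 + n ]
    ≡⟨ [∣]-suc 1 (zigzag L) (9 + n) ⟨
  tails 1 (10 + n) ∎
  where
  open ≤-Reasoning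
  p : Word
  p = L ∷ R ∷ L ∷ R ∷ R ∷ L ∷ R ∷ []

  -- For `k` = 1 nothing that follows LRLR starts with RR. Such words therefore continue `p` by L or
  -- RL only, which leaves `p ++ R ∷ R ∷ []` free for the third summand.
  split : tails 1 (7 + n) ≤ 1 [ p ++ L ∷ [] ∣ 6 + n ] + 1 [ p ++ R ∷ L ∷ [] ∣ 5 + n ]
  split = begin
    tails 1 (7 + n)
      ≡⟨ [∣]-suc 1 (zigzag L) (6 + n) ⟩
    1 [ zigzag L ++ L ∷ [] ∣ 6 + n ] + 1 [ zigzag L ++ R ∷ [] ∣ 6 + n ]
      ≡⟨ cong (1 [ zigzag L ++ L ∷ [] ∣ 6 + n ] +_) ([∣]-suc 1 (zigzag L ++ R ∷ []) (5 + n)) ⟩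
    1 [ zigzag L ++ L ∷ [] ∣ 6 + n ] +
      (1 [ zigzag L ++ R ∷ L ∷ [] ∣ 5 + n ] + 1 [ zigzag L ++ R ∷ R ∷ [] ∣ 5 + n ])
      ≡⟨ cong (λ e → 1 [ zigzag L ++ L ∷ [] ∣ 6 + n ] + (1 [ zigzag L ++ R ∷ L ∷ [] ∣ 5 + n ] + e))
           ([∣]-empty (zigzag L ++ R ∷ R ∷ []) (λ { w (() , _) }) (5 + n)) ⟩
    1 [ zigzag L ++ L ∷ [] ∣ 6 + n ] + (1 [ zigzag L ++ R ∷ L ∷ [] ∣ 5 + n ] + 0)
      ≡⟨ cong (1 [ zigzag L ++ L ∷ [] ∣ 6 + n ] +_) (+-identityʳ _) ⟩
    1 [ zigzag L ++ L ∷ [] ∣ 6 + n ] + 1 [ zigzag L ++ R ∷ L ∷ [] ∣ 5 + n ]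
      ≤⟨ +-mono-≤ (relax-count 0 (L ∷ []) (6 + n)) (relax-count 0 (R ∷ L ∷ []) (5 + n)) ⟩
    1 [ p ++ L ∷ [] ∣ 6 + n ] + 1 [ p ++ R ∷ L ∷ [] ∣ 5 + n ] ∎

-- For `k` = 2 the word of length 9 is RLLRL followed by RLRL. It differs from RLR in its third
-- letter, so nothing is counted twice.
tails-growth₂ : ∀ n → tails 2 (9 + n) + (tails 2 (7 + n) + tails 2 (1 + n)) ≤ tails 2 (10 + n)
tails-growth₂ n = begin
  tails 2 (9 + n) + (tails 2 (7 + n) + tails 2 (1 + n))
    ≤⟨ +-mono-≤ (tails-suc 1 (9 + n)) (begin
      tails 2 (7 + n) + tails 2 (1 + n)
        ≤⟨ +-mono-≤ (relax-count 1 [] (7 + n))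
             (≤-trans (tails≤zigzag R (1 + n))
               (≤-trans (glue (zigzag L ++ R ∷ L ∷ L ∷ R ∷ L ∷ []) R (1 + n)
                   (from-yes (valid? 2 (zigzag L ++ R ∷ L ∷ L ∷ R ∷ L ∷ zigzag R))))
                 (extend (zigzag L ++ R ∷ L ∷ L ∷ []) (R ∷ L ∷ zigzag R) (1 + n)))) ⟩
      2 [ zigzag L ++ R ∷ L ∷ R ∷ [] ∣ 7 + n ] + 2 [ zigzag L ++ R ∷ L ∷ L ∷ [] ∣ 7 + n ]
        ≡⟨ +-comm _ (2 [ zigzag L ++ R ∷ L ∷ L ∷ [] ∣ 7 + n ]) ⟩
      2 [ zigzag L ++ R ∷ L ∷ L ∷ [] ∣ 7 + n ] + 2 [ zigzag L ++ R ∷ L ∷ R ∷ [] ∣ 7 + n ]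
        ≡⟨ [∣]-suc 2 (zigzag L ++ R ∷ L ∷ []) (7 + n) ⟨
      2 [ zigzag L ++ R ∷ L ∷ [] ∣ 8 + n ]
        ≤⟨ extend (zigzag L ++ R ∷ []) (L ∷ []) (8 + n) ⟩
      2 [ zigzag L ++ R ∷ [] ∣ 9 + n ] ∎) ⟩
  2 [ zigzag L ++ L ∷ [] ∣ 9 + n ] + 2 [ zigzag L ++ R ∷ [] ∣ 9 + n ]
    ≡⟨ [∣]-suc 2 (zigzag L) (9 + n) ⟨
  tails 2 (10 + n) ∎
  where open ≤-Reasoning

OneOrTwo : ℕ → Set
OneOrTwo k = k ≡ 1 ⊎ k ≡ 2

tails-growth : ∀ {k} → OneOrTwo k → ∀ n →
  tails k (9 + n) + (tails k (7 + n) + tails k (1 + n)) ≤ tails k (10 + n)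
tails-growth (inj₁ refl) = tails-growth₁
tails-growth (inj₂ refl) = tails-growth₂

-- For `k` = 1 the word LLRR already violates the condition at its first letter. For `k` = 2 it may
-- be preceded by LRLR, whose conditions are all decided within LRLRLLRR.
LLRR≤tails : ∀ {k} → OneOrTwo k → ∀ n → k [ L ∷ L ∷ R ∷ R ∷ [] ∣ n ] ≤ tails k (4 + n)
LLRR≤tails (inj₁ refl) n = subst (_≤ tails 1 (4 + n))
  (sym ([∣]-empty (L ∷ L ∷ R ∷ R ∷ []) (λ { w (() , _) }) n)) z≤n
LLRR≤tails (inj₂ refl) n = ≤-trans
  ([∣]-mono (L ∷ L ∷ R ∷ R ∷ []) (zigzag L ++ L ∷ L ∷ R ∷ R ∷ [])
    (λ w v → tt , tt , tt , tt , v) n)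
  (extend (zigzag L) (L ∷ L ∷ R ∷ R ∷ []) n)

-- Words that follow a double letter

runs : ℕ → ℕ → ℕ
runs k n = k [ L ∷ L ∷ [] ∣ n ]

runs-step : ∀ k n → runs k (3 + n) ≤
  runs k (2 + n) + ((runs k n + tails k n) + k [ L ∷ L ∷ R ∷ R ∷ [] ∣ 1 + n ])
runs-step k n = begin
  runs k (3 + n)
    ≡⟨ [∣]-suc k (L ∷ L ∷ []) (2 + n) ⟩
  k [ L ∷ L ∷ L ∷ [] ∣ 2 + n ] + k [ L ∷ L ∷ R ∷ [] ∣ 2 + n ]
    ≡⟨ cong (k [ L ∷ L ∷ L ∷ [] ∣ 2 + n ] +_) (trans ([∣]-suc k (L ∷ L ∷ R ∷ []) (1 + n))
         (cong (_+ k [ L ∷ L ∷ R ∷ R ∷ [] ∣ 1 + n ]) ([∣]-suc k (L ∷ L ∷ R ∷ L ∷ []) n))) ⟩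
  k [ L ∷ L ∷ L ∷ [] ∣ 2 + n ] +
    ((k [ L ∷ L ∷ R ∷ L ∷ L ∷ [] ∣ n ] + k [ L ∷ zigzag L ∣ n ]) + k [ L ∷ L ∷ R ∷ R ∷ [] ∣ 1 + n ])
    ≤⟨ +-mono-≤ (drop-prefix (L ∷ []) (L ∷ L ∷ []) (2 + n))
         (+-monoˡ-≤ (k [ L ∷ L ∷ R ∷ R ∷ [] ∣ 1 + n ])
           (+-mono-≤ (drop-prefix (L ∷ L ∷ R ∷ []) (L ∷ L ∷ []) n) (drop-prefix (L ∷ []) (zigzag L) n))) ⟩
  runs k (2 + n) + ((runs k n + tails k n) + k [ L ∷ L ∷ R ∷ R ∷ [] ∣ 1 + n ]) ∎
  where open ≤-Reasoning

tails≤words : ∀ {k} n → tails k n ≤ k [ [] ∣ n ]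
tails≤words = drop-prefix (zigzag L) []

tails>0 : ∀ k n → 1 ≤ tails (suc k) n
tails>0 k zero    = ≤-reflexive (sym ([∣]-zero (zigzag L) (tt , tt , tt , tt , tt)))
tails>0 k (suc n) = ≤-trans (tails>0 k n) (≤-trans (tails-suc k n) (extend (zigzag L) (L ∷ []) n))

-- Multiplied by K, y dominates the recurrence of x, so the bound propagates from the ten initial
-- values by strong induction; `b` in `go` is the induction bound.
recurrence-bound : ∀ (x y : ℕ → ℕ) K → (∀ n → n ≤ 9 → x n ≤ y n * K) →
  (∀ n → x (10 + n) ≤ x (9 + n) + (x (7 + n) + y (1 + n) * K)) →
  (∀ n → y (9 + n) + (y (7 + n) + y (1 + n)) ≤ y (10 + n)) →
  ∀ n → x n ≤ y n * K
recurrence-bound x y K base x-step y-step n = go n n ≤-refl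
  where
  open ≤-Reasoning
  go : ∀ b n → n ≤ b → x n ≤ y n * K
  go b n n≤b with n ≤? 9
  ... | yes n≤9 = base n n≤9
  ... | no n≰9 with m≤n⇒∃[o]m+o≡n (≰⇒> n≰9)
  go (suc b) .(10 + m) (s≤s 9+m≤b) | no _ | m , refl = begin
    x (10 + m)
      ≤⟨ x-step m ⟩
    x (9 + m) + (x (7 + m) + y (1 + m) * K)
      ≤⟨ +-mono-≤ (go b (9 + m) 9+m≤b)
           (+-monoˡ-≤ (y (1 + m) * K) (go b (7 + m) (≤-trans (m≤n+m (7 + m) 2) 9+m≤b))) ⟩
    y (9 + m) * K + (y (7 + m) * K + y (1 + m) * K)
      ≡⟨ cong (y (9 + m) * K +_) (*-distribʳ-+ K (y (7 + m)) _) ⟨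
    y (9 + m) * K + (y (7 + m) + y (1 + m)) * K
      ≡⟨ *-distribʳ-+ K (y (9 + m)) _ ⟨
    (y (9 + m) + (y (7 + m) + y (1 + m))) * K
      ≤⟨ *-monoˡ-≤ K (y-step m) ⟩
    y (10 + m) * K ∎

runs≤tails : ∀ {j} → let k = suc j in OneOrTwo k → ∃[ K ] ∀ n → runs k n ≤ tails k n * K
-- Going back to index 1 + n costs `2 ^ 6` from 7 + n, and `2 ^ 11` from 12 + n, the index that
-- `LLRR≤tails` produces. The initial values only need `2 ^ 9`.
runs≤tails {j} k∈ = 2 ^ 6 + 2 ^ 11 ,
  recurrence-bound (runs k) (tails k) (2 ^ 6 + 2 ^ 11) base step (tails-growth k∈)
  where
  open ≤-Reasoning
  k = suc j

  base : ∀ n → n ≤ 9 → runs k n ≤ tails k n * (2 ^ 6 + 2 ^ 11)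
  base n n≤9 = begin
    runs k n                        ≤⟨ lengthen (L ∷ L ∷ []) 0 n ⟩
    runs k 0 * 2 ^ n                ≡⟨ cong (_* 2 ^ n) ([∣]-zero (L ∷ L ∷ []) (tt , tt , tt)) ⟩
    1 * 2 ^ n                       ≤⟨ *-mono-≤ (tails>0 j n) (≤-trans (^-monoʳ-≤ 2 n≤9) (m≤m+n (2 ^ 9) _)) ⟩
    tails k n * (2 ^ 6 + 2 ^ 11)    ∎

  regroup : ∀ a b c d → a + ((b + c) + d) ≡ a + (b + (c + d))
  regroup = solve-∀

  step : ∀ n → runs k (10 + n) ≤
    runs k (9 + n) + (runs k (7 + n) + tails k (1 + n) * (2 ^ 6 + 2 ^ 11))
  step n = begin
    runs k (10 + n)
      ≤⟨ runs-step k (7 + n) ⟩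
    runs k (9 + n) + ((runs k (7 + n) + tails k (7 + n)) + k [ L ∷ L ∷ R ∷ R ∷ [] ∣ 8 + n ])
      ≡⟨ regroup (runs k (9 + n)) (runs k (7 + n)) (tails k (7 + n)) _ ⟩
    runs k (9 + n) + (runs k (7 + n) + (tails k (7 + n) + k [ L ∷ L ∷ R ∷ R ∷ [] ∣ 8 + n ]))
      ≤⟨ +-monoʳ-≤ (runs k (9 + n)) (+-monoʳ-≤ (runs k (7 + n))
           (+-mono-≤ (later 6) (≤-trans (LLRR≤tails k∈ (8 + n)) (later 11)))) ⟩
    runs k (9 + n) + (runs k (7 + n) + (tails k (1 + n) * 2 ^ 6 + tails k (1 + n) * 2 ^ 11))
      ≡⟨ cong (λ t → runs k (9 + n) + (runs k (7 + n) + t)) (*-distribˡ-+ (tails k (1 + n)) (2 ^ 6) (2 ^ 11)) ⟨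
    runs k (9 + n) + (runs k (7 + n) + tails k (1 + n) * (2 ^ 6 + 2 ^ 11)) ∎
    where
    later : ∀ i → tails k (i + (1 + n)) ≤ tails k (1 + n) * 2 ^ i
    later i = subst (λ m → tails k m ≤ tails k (1 + n) * 2 ^ i) (+-comm (1 + n) i)
      (lengthen (zigzag L) (1 + n) i)

-- A word that starts with L starts with LL, LRR, LRLL or LRLR. Dropping letters in front leaves a
-- double letter or the zigzag; the words that start with R follow by symmetry.
words≤tails : ∀ {k} K → (∀ n → runs k n ≤ tails k n * K) →
  ∃[ K′ ] ∀ n → k [ [] ∣ 4 + n ] ≤ tails k n * K′
words≤tails {k} K bound = (c + c) , λ n → begin
  k [ [] ∣ 4 + n ]
    ≡⟨ [∣]-suc k [] (3 + n) ⟩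
  k [ L ∷ [] ∣ 3 + n ] + k [ R ∷ [] ∣ 3 + n ]
    ≤⟨ +-mono-≤ (half n) (≤-trans (swap-letters (L ∷ []) (3 + n)) (half n)) ⟩
  tails k n * c + tails k n * c
    ≡⟨ *-distribˡ-+ (tails k n) c c ⟨
  tails k n * (c + c) ∎
  where
  open ≤-Reasoning
  c = 4 * K + (2 * K + (K + 1))

  later : ∀ i n → runs k (i + n) ≤ tails k n * 2 ^ i * K
  later i n = ≤-trans (bound (i + n)) (*-monoˡ-≤ K
    (subst (λ m → tails k m ≤ tails k n * 2 ^ i) (+-comm n i) (lengthen (zigzag L) n i)))

  collect : ∀ t K → t * 4 * K + (t * 2 * K + (t * 1 * K + t)) ≡ t * (4 * K + (2 * K + (K + 1)))
  collect = solve-∀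

  third : ∀ n → k [ L ∷ R ∷ L ∷ [] ∣ 1 + n ] ≤ runs k n + tails k n
  third n = ≤-trans (≤-reflexive ([∣]-suc k (L ∷ R ∷ L ∷ []) n))
    (+-monoˡ-≤ (tails k n) (drop-prefix (L ∷ R ∷ []) (L ∷ L ∷ []) n))

  half : ∀ n → k [ L ∷ [] ∣ 3 + n ] ≤ tails k n * c
  half n = begin
    k [ L ∷ [] ∣ 3 + n ]
      ≡⟨ [∣]-suc k (L ∷ []) (2 + n) ⟩
    runs k (2 + n) + k [ L ∷ R ∷ [] ∣ 2 + n ]
      ≡⟨ cong (runs k (2 + n) +_) (trans ([∣]-suc k (L ∷ R ∷ []) (1 + n))
           (+-comm (k [ L ∷ R ∷ L ∷ [] ∣ 1 + n ]) _)) ⟩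
    runs k (2 + n) + (k [ L ∷ R ∷ R ∷ [] ∣ 1 + n ] + k [ L ∷ R ∷ L ∷ [] ∣ 1 + n ])
      ≤⟨ +-monoʳ-≤ (runs k (2 + n)) (+-mono-≤
           (≤-trans (drop-prefix (L ∷ []) (R ∷ R ∷ []) (1 + n)) (swap-letters (L ∷ L ∷ []) (1 + n)))
           (third n)) ⟩
    runs k (2 + n) + (runs k (1 + n) + (runs k n + tails k n))
      ≤⟨ +-mono-≤ (later 2 n) (+-mono-≤ (later 1 n) (+-monoˡ-≤ (tails k n) (later 0 n))) ⟩
    tails k n * 4 * K + (tails k n * 2 * K + (tails k n * 1 * K + tails k n))
      ≡⟨ collect (tails k n) K ⟩
    tails k n * c ∎

-- Any valid u can be followed by a suitable zigzag and then by whatever may follow that zigzag; the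
-- 4 counts the letters of the zigzag.
words*tails≤words : ∀ k m n → suc k [ [] ∣ m ] * tails (suc k) n ≤ suc k [ [] ∣ m + (4 + n) ]
words*tails≤words k m n = words-join join m
  where
  join : ∀ u → Valid (suc k) u → tails (suc k) n ≤ suc k [ u ∣ 4 + n ]
  join []      _ = extend [] (zigzag L) n
  join (b ∷ w) v = ≤-trans (tails≤zigzag (turn b w) n)
    (≤-trans (glue (b ∷ w) (turn b w) n (valid-turn b w v))
      (extend (b ∷ w) (zigzag (turn b w)) n))

words>0 : ∀ k n → 1 ≤ suc k [ [] ∣ n ]
words>0 k n = ≤-trans (tails>0 k n) (tails≤words n)

-- The second factor is replaced by a multiple of `tails`, which can be joined to any word. Removing
-- the four extra letters at the end costs the factor 16.
words-quasimultiplicative : ∀ {j} K → let k = suc j in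
  (∀ n → k [ [] ∣ 4 + n ] ≤ tails k n * K) →
  ∀ m n → k [ [] ∣ m ] * k [ [] ∣ n ] ≤ k [ [] ∣ m + n ] * (16 * K)
words-quasimultiplicative {j} K bound m n = begin
  k [ [] ∣ m ] * k [ [] ∣ n ]
    ≤⟨ *-monoʳ-≤ (k [ [] ∣ m ]) (≤-trans (longer n) (bound n)) ⟩
  k [ [] ∣ m ] * (tails k n * K)
    ≡⟨ *-assoc (k [ [] ∣ m ]) (tails k n) K ⟨
  k [ [] ∣ m ] * tails k n * K
    ≤⟨ *-monoˡ-≤ K (words*tails≤words j m n) ⟩
  k [ [] ∣ m + (4 + n) ] * K
    ≡⟨ cong (λ l → k [ [] ∣ l ] * K) (trans (cong (m +_) (+-comm 4 n)) (sym (+-assoc m n 4))) ⟩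
  k [ [] ∣ m + n + 4 ] * K
    ≤⟨ *-monoˡ-≤ K (lengthen [] (m + n) 4) ⟩
  k [ [] ∣ m + n ] * 16 * K
    ≡⟨ *-assoc (k [ [] ∣ m + n ]) 16 K ⟩
  k [ [] ∣ m + n ] * (16 * K) ∎
  where
  open ≤-Reasoning
  k = suc j

  longer : ∀ n → k [ [] ∣ n ] ≤ k [ [] ∣ 4 + n ]
  longer n = begin
    k [ [] ∣ n ]                 ≡⟨ *-identityʳ _ ⟨
    k [ [] ∣ n ] * 1             ≤⟨ *-monoʳ-≤ (k [ [] ∣ n ]) (tails>0 j 0) ⟩
    k [ [] ∣ n ] * tails k 0     ≤⟨ words*tails≤words j n 0 ⟩
    k [ [] ∣ n + 4 ]             ≡⟨ cong (λ l → k [ [] ∣ l ]) (+-comm n 4) ⟩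
    k [ [] ∣ 4 + n ]             ∎

words-supermultiplicative : ∀ {j} → let k = suc j in OneOrTwo k →
  ∃[ K ] ∀ m n → k [ [] ∣ m ] * k [ [] ∣ n ] ≤ k [ [] ∣ m + n ] * K
words-supermultiplicative {j} k∈ =
  let K  , runs-bound  = runs≤tails k∈
      K′ , words-bound = words≤tails K runs-bound
  in 16 * K′ , words-quasimultiplicative K′ words-bound

-- Permutations as words

-- The arrangement of v, …, v + length w in which the letters of w tell to which
-- end of the remaining values each of v, v + 1, … is attached.
build : ℕ → Word → List ℕ
build v []      = v ∷ []
build v (L ∷ w) = v ∷ build (suc v) w
build v (R ∷ w) = build (suc v) w ∷ʳ v

-- Convex sequences of natural numbers

FirstStep : ℕ → ℕ → List ℕ → Set
FirstStep k x (y ∷ z ∷ _) = x + z ≤ k + (y + y)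
FirstStep k x _           = ⊤

Convex : ℕ → List ℕ → Set
Convex k []      = ⊤
Convex k (x ∷ l) = FirstStep k x l × Convex k l

convex⇒triple : ∀ {k} u {x y z v} → Convex k (u ++ x ∷ y ∷ z ∷ v) → x + z ≤ k + (y + y)
convex⇒triple []      (c , _) = c
convex⇒triple (_ ∷ u) (_ , c) = convex⇒triple u c

triples⇒convex : ∀ {k} l →
  (∀ u {x y z v} → l ≡ u ++ x ∷ y ∷ z ∷ v → x + z ≤ k + (y + y)) → Convex k l
triples⇒convex []              t = tt
triples⇒convex (x ∷ [])        t = tt , tt
triples⇒convex {k} (x ∷ y ∷ []) t = tt , triples⇒convex {k} (y ∷ []) λ u → t (x ∷ u) ∘ cong (x ∷_)
triples⇒convex {k} (x ∷ y ∷ z ∷ l) t = t [] refl ,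
  triples⇒convex {k} (y ∷ z ∷ l) λ u → t (x ∷ u) ∘ cong (x ∷_)

convex-++ : ∀ {k} u {l} v → Convex k (u ++ l ++ v) → Convex k l
convex-++ u v c = triples⇒convex _ λ
  { u′ {x} {y} {z} {v′} refl → convex⇒triple (u ++ u′) (subst (Convex _)
      (trans (cong (u ++_) (++-assoc u′ (x ∷ y ∷ z ∷ v′) v)) (sym (++-assoc u u′ _))) c) }

-- The inequality is symmetric in the two outer entries of a triple.
convex-reverse : ∀ {k} l → Convex k l → Convex k (reverse l)
convex-reverse {k} l c = triples⇒convex (reverse l) λ u {x} {y} {z} {v} eq →
  subst (_≤ k + (y + y)) (+-comm z x) (convex⇒triple (reverse v) (subst (Convex k) (flipped u eq) c))
  where
  flipped : ∀ u {x y z v} → reverse l ≡ u ++ x ∷ y ∷ z ∷ v →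
            l ≡ reverse v ++ z ∷ y ∷ x ∷ reverse u
  flipped u {x} {y} {z} {v} eq = begin
    l                                                 ≡⟨ reverse-involutive l ⟨
    reverse (reverse l)                               ≡⟨ cong reverse eq ⟩
    reverse (u ++ x ∷ y ∷ z ∷ v)                      ≡⟨ reverse-++ u _ ⟩
    reverse ((x ∷ y ∷ z ∷ []) ++ v) ++ reverse u      ≡⟨ cong (_++ reverse u) (reverse-++ (x ∷ y ∷ z ∷ []) v) ⟩
    (reverse v ++ z ∷ y ∷ x ∷ []) ++ reverse u        ≡⟨ ++-assoc (reverse v) (z ∷ y ∷ x ∷ []) _ ⟩
    reverse v ++ z ∷ y ∷ x ∷ reverse u                ∎
    where open ≡-Reasoning

reverse-build : ∀ v w → reverse (build v w) ≡ build v (map not w)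
reverse-build v []      = refl
reverse-build v (L ∷ w) =
  trans (unfold-reverse v (build (suc v) w)) (cong (_∷ʳ v) (reverse-build (suc v) w))
reverse-build v (R ∷ w) =
  trans (reverse-++ (build (suc v) w) [ v ]) (cong (v ∷_) (reverse-build (suc v) w))

build-∷ : ∀ v w → ∃[ x ] ∃[ l ] build v w ≡ x ∷ l × v ≤ x
build-∷ v []      = v , [] , refl , ≤-refl
build-∷ v (L ∷ w) = v , _ , refl , ≤-refl
build-∷ v (R ∷ w) with build-∷ (suc v) w
... | x , l , eq , v<x = x , l ∷ʳ v , cong (_∷ʳ v) eq , ≤-trans (n≤1+n v) v<x

build-∷∷ : ∀ v b w → ∃[ x ] ∃[ y ] ∃[ l ] build v (b ∷ w) ≡ x ∷ y ∷ l
build-∷∷ v L w with build-∷ (suc v) w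
... | x , l , eq , _ = v , x , l , cong (v ∷_) eq
build-∷∷ v R w with build-∷ (suc v) w
... | x , []    , eq , _ = x , v , [] , cong (_∷ʳ v) eq
... | x , y ∷ l , eq , _ = x , y , l ∷ʳ v , cong (_∷ʳ v) eq

-- The first entry reveals the first letter: it is v after L and larger than v after R. The empty
-- word gives the only arrangement with a single entry.
build-injective : ∀ {v w w′} → build v w ≡ build v w′ → w ≡ w′
build-injective {v} {[]}    {[]}     eq = refl
build-injective {v} {[]}    {b ∷ w′} eq with build-∷∷ v b w′
... | _ , _ , _ , eq′ = contradiction (trans eq eq′) λ ()
build-injective {v} {b ∷ w} {[]}     eq with build-∷∷ v b w
... | _ , _ , _ , eq′ = contradiction (trans (sym eq) eq′) λ ()
build-injective {v} {L ∷ w} {L ∷ w′} eq = cong (L ∷_) (build-injective (∷-injectiveʳ eq))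
build-injective {v} {R ∷ w} {R ∷ w′} eq =
  cong (R ∷_) (build-injective (∷ʳ-injectiveˡ (build (suc v) w) _ eq))
build-injective {v} {L ∷ w} {R ∷ w′} eq with build-∷ (suc v) w′
... | x , l , eq′ , v<x = contradiction (∷-injectiveˡ (trans eq (cong (_∷ʳ v) eq′))) (<⇒≢ v<x)
build-injective {v} {R ∷ w} {L ∷ w′} eq with build-∷ (suc v) w
... | x , l , eq′ , v<x = contradiction (∷-injectiveˡ (trans (sym eq) (cong (_∷ʳ v) eq′))) (<⇒≢ v<x)

-- Validity of a word as convexity of its arrangement

HeadBound : ℕ → List ℕ → Set
HeadBound b []      = ⊤
HeadBound b (x ∷ _) = x ≤ b

-- Each leading R sends the current least value to the far end, so the head of `build v w` is v plus
-- the number of leading letters R.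
closes⇔headBound : ∀ m v w → Closes m w ⇔ HeadBound (v + m) (build v w)
closes⇔headBound m v []      = mk⇔ (λ _ → m≤m+n v m) _
closes⇔headBound m v (L ∷ w) = mk⇔ (λ _ → m≤m+n v m) _
closes⇔headBound zero v (R ∷ w) with build (suc v) w | build-∷ (suc v) w
... | _ | x , l , refl , v<x =
  mk⇔ ⊥-elim λ x≤v → contradiction (subst (x ≤_) (+-identityʳ v) x≤v) (<⇒≱ v<x)
closes⇔headBound (suc m) v (R ∷ w)
  with build (suc v) w | build-∷ (suc v) w | closes⇔headBound m (suc v) w
... | _ | x , l , refl , _ | eqv = subst (λ b → Closes m w ⇔ (x ≤ b)) (sym (+-suc v m)) eqv

-- The equation says m = k + (v - x - 1), the allowance accumulated on the way from x to v; every R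
-- raises v and m together.
opens⇔firstStep : ∀ {k x} m v w → x ≤ v → x + suc m ≡ v + k →
                  Opens m w ⇔ FirstStep k x (build v w)
opens⇔firstStep m v [] _ _ = mk⇔ _ _
opens⇔firstStep {k} {x} m v (L ∷ w) x≤v eq
  with build (suc v) w | build-∷ (suc v) w | closes⇔headBound m (suc v) w
... | _ | y , l , refl , _ | eqv = ⇔-trans eqv (mk⇔
  (λ y≤ → subst (x + y ≤_) shifted (+-monoʳ-≤ x y≤))
  (λ x+y≤ → +-cancelˡ-≤ x y (suc v + m) (subst (x + y ≤_) (sym shifted) x+y≤)))
  where
  swap : ∀ x v m → x + (suc v + m) ≡ v + (x + suc m)
  swap = solve-∀

  shifted : x + (suc v + m) ≡ k + (v + v)
  shifted = begin
    x + (suc v + m)   ≡⟨ swap x v m ⟩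
    v + (x + suc m)   ≡⟨ cong (v +_) eq ⟩
    v + (v + k)       ≡⟨ +-assoc v v k ⟨
    v + v + k         ≡⟨ +-comm (v + v) k ⟩
    k + (v + v)       ∎
    where open ≡-Reasoning
-- The arrangement is `suc v` followed by v, and the inequality holds since neither x nor v exceeds
-- `suc v`.
opens⇔firstStep {k} {x} m v (R ∷ []) x≤v eq = mk⇔
  (λ _ → ≤-trans (+-mono-≤ (≤-trans x≤v (n≤1+n v)) (n≤1+n v)) (m≤n+m (suc v + suc v) k)) _
opens⇔firstStep {k} {x} m v (R ∷ b ∷ w) x≤v eq
  with build (suc v) (b ∷ w) | build-∷∷ (suc v) b w
     | opens⇔firstStep {k} {x} (suc m) (suc v) (b ∷ w) (≤-trans x≤v (n≤1+n v))
         (trans (+-suc x (suc m)) (cong suc eq))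
... | _ | y , z , l , refl | eqv = eqv

-- The condition at the first letter concerns the one triple that has v at its end. If v is attached
-- on the right, reversal leads back to the other case with the letters exchanged.
valid⇔convex : ∀ {k} v w → Valid k w ⇔ Convex k (build v w)
valid⇔convex v [] = mk⇔ _ _
valid⇔convex {k} v (L ∷ w) = mk⇔
  (λ (o , c) → to step o , to (valid⇔convex (suc v) w) c)
  (λ (o , c) → from step o , from (valid⇔convex (suc v) w) c)
  where
  step : Opens k (map (L xor_) w) ⇔ FirstStep k v (build (suc v) w)
  step = subst (λ w′ → Opens k w′ ⇔ FirstStep k v (build (suc v) w)) (sym (map-id w))
    (opens⇔firstStep k (suc v) w (n≤1+n v) (+-suc v k))
valid⇔convex {k} v (R ∷ w) = mk⇔
  (λ (o , c) → subst (Convex k) mirror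
    (convex-reverse (v ∷ build (suc v) (map not w))
      (to step o , subst (Convex k) (reverse-build (suc v) w)
        (convex-reverse (build (suc v) w) (to (valid⇔convex (suc v) w) c)))))
  (λ c → let c′ = subst (Convex k) (reverse-build v (R ∷ w)) (convex-reverse (build v (R ∷ w)) c)
         in from step (proj₁ c′) , from (valid⇔convex (suc v) w)
              (convex-++ [] [ v ] c))
  where
  step : Opens k (map not w) ⇔ FirstStep k v (build (suc v) (map not w))
  step = opens⇔firstStep k (suc v) (map not w) (n≤1+n v) (+-suc v k)

  mirror : reverse (v ∷ build (suc v) (map not w)) ≡ build (suc v) w ∷ʳ v
  mirror = trans (cong reverse (sym (reverse-build v (R ∷ w)))) (reverse-involutive _)

-- Convex rearrangements of an interval

range : ℕ → ℕ → List ℕ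
range v zero    = v ∷ []
range v (suc m) = v ∷ range (suc v) m

∈-range⁻ : ∀ {x} v m → x ∈ range v m → v ≤ x × x ≤ v + m
∈-range⁻ v zero    (here refl) = ≤-refl , m≤m+n v 0
∈-range⁻ v (suc m) (here refl) = ≤-refl , m≤m+n v (suc m)
∈-range⁻ v (suc m) (there x∈) with ∈-range⁻ (suc v) m x∈
... | v<x , x≤ = <⇒≤ v<x , ≤-trans x≤ (≤-reflexive (sym (+-suc v m)))

∈-range⁺ : ∀ {x} v m → v ≤ x → x ≤ v + m → x ∈ range v m
∈-range⁺ {x} v zero    v≤x x≤ = here (≤-antisym (subst (x ≤_) (+-identityʳ v) x≤) v≤x)
∈-range⁺ {x} v (suc m) v≤x x≤ with m≤n⇒m<n∨m≡n v≤x
... | inj₁ v<x  = there (∈-range⁺ (suc v) m v<x (≤-trans x≤ (≤-reflexive (+-suc v m))))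
... | inj₂ refl = here refl

length-range : ∀ v m → length (range v m) ≡ suc m
length-range v zero    = refl
length-range v (suc m) = cong suc (length-range (suc v) m)

range-unique : ∀ v m → Unique (range v m)
range-unique v zero    = [] ∷ []
range-unique v (suc m) =
  All.tabulate (λ x∈ v≡x → <⇒≢ (proj₁ (∈-range⁻ (suc v) m x∈)) v≡x) ∷ range-unique (suc v) m

build-↭ : ∀ v w → build v w ↭ range v (length w)
build-↭ v []      = ↭-refl
build-↭ v (L ∷ w) = ↭-prep v (build-↭ (suc v) w)
build-↭ v (R ∷ w) = ↭-trans (↭-sym (∷↭∷ʳ v (build (suc v) w))) (↭-prep v (build-↭ (suc v) w))

unique-resp-↭ : ∀ {xs ys : List ℕ} → xs ↭ ys → Unique xs → Unique ys
unique-resp-↭ xs↭ys = ↭ₛ.Unique-resp-↭ (setoid ℕ) (↭⇒↭ₛ xs↭ys)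

-- A value below both neighbours makes the second difference at least 1 + 2.
no-valley : ∀ {k x v z} → k ≤ 2 → v < x → v < z → x ≢ z → x + z ≤ k + (v + v) → ⊥
no-valley {k} {x} {v} {z} k≤2 v<x v<z x≢z x+z≤ = x≢z (trans x≡ (sym z≡))
  where
  bound : x + z ≤ suc v + suc v
  bound = ≤-trans x+z≤ (≤-trans (+-monoˡ-≤ (v + v) k≤2) (≤-reflexive (cong suc (sym (+-suc v v)))))
  x≡ : x ≡ suc v
  x≡ = ≤-antisym (+-cancelʳ-≤ (suc v) x (suc v) (≤-trans (+-monoʳ-≤ x v<z) bound)) v<x
  z≡ : z ≡ suc v
  z≡ = ≤-antisym (+-cancelˡ-≤ (suc v) z (suc v) (≤-trans (+-monoˡ-≤ z v<x) bound)) v<z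

convex⇒build : ∀ {k} → k ≤ 2 → ∀ m v l → l ↭ range v m → Convex k l →
               ∃[ w ] length w ≡ m × l ≡ build v w
convex⇒build k≤2 zero v (x ∷ [])    l↭ c with ∈-resp-↭ l↭ (here refl)
... | here refl = [] , refl , refl
convex⇒build k≤2 zero v []          l↭ c = contradiction (↭-length l↭) λ ()
convex⇒build k≤2 zero v (x ∷ y ∷ l) l↭ c = contradiction (↭-length l↭) λ ()
convex⇒build {k} k≤2 (suc m) v l l↭ c with ∈-∃++ (∈-resp-↭ (↭-sym l↭) (here refl))
... | [] , zs , refl with convex⇒build k≤2 m (suc v) zs (drop-mid [] [] l↭) (proj₂ c)
...   | w , len , refl = L ∷ w , cong suc len , refl
convex⇒build {k} k≤2 (suc m) v l l↭ c | ys@(_ ∷ _) , [] , refl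
  with convex⇒build k≤2 m (suc v) ys
         (subst (_↭ range (suc v) m) (++-identityʳ ys) (drop-mid ys [] l↭)) (convex-++ [] [ v ] c)
... | w , len , eq = R ∷ w , cong suc len , cong (_∷ʳ v) eq
-- Here the least value v is interior. `initLast` exposes its left neighbour x; both x and z exceed
-- v and they differ, against `no-valley`.
convex⇒build {k} k≤2 (suc m) v l l↭ c | y ∷ ys , z ∷ zs , refl =
  ⊥-elim (valley (initLast (y ∷ ys)) refl)
  where
  valley : ∀ {us} → InitLast us → y ∷ ys ≡ us → ⊥
  valley []        ()
  valley (us ∷ʳ′ x) eq = no-valley k≤2 (above (∈-++⁺ˡ (∈-++⁺ʳ us (here refl))))
      (above (∈-++⁺ʳ (us ∷ʳ x) (here refl))) (distinct {us} unique-rest)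
      (convex⇒triple us (subst (Convex k) l≡ c))
    where
    l≡ : (y ∷ ys) ++ v ∷ z ∷ zs ≡ us ++ x ∷ v ∷ z ∷ zs
    l≡ = trans (cong (_++ v ∷ z ∷ zs) eq) (++-assoc us [ x ] _)

    rest↭ : (us ∷ʳ x) ++ z ∷ zs ↭ range (suc v) m
    rest↭ = drop-mid (us ∷ʳ x) [] (subst (λ ps → ps ++ v ∷ z ∷ zs ↭ range v (suc m)) eq l↭)

    above : ∀ {u} → u ∈ (us ∷ʳ x) ++ z ∷ zs → v < u
    above = proj₁ ∘ ∈-range⁻ (suc v) m ∘ ∈-resp-↭ rest↭

    unique-rest : Unique (us ++ x ∷ z ∷ zs)
    unique-rest = unique-resp-↭ (↭-sym (↭-trans (↭-reflexive (sym (++-assoc us [ x ] (z ∷ zs)))) rest↭))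
      (range-unique (suc v) m)

    distinct : ∀ {us} → Unique (us ++ x ∷ z ∷ zs) → x ≢ z
    distinct {[]}     ((x≢z ∷ _) ∷ _) = x≢z
    distinct {_ ∷ us} (_ ∷ u)         = distinct {us} u

-- Comparison of lists without repetitions

unique-⊆ : ∀ {A : Set} {xs ys : List A} → Unique xs → (∀ {x} → x ∈ xs → x ∈ ys) →
           ∃[ zs ] ys ↭ xs ++ zs
unique-⊆ {xs = []}     {ys} _ _ = ys , ↭-refl
unique-⊆ {xs = x ∷ xs} u@(x∉ ∷ uniq) ⊆ys with ∈-∃++ (⊆ys (here refl))
... | ps , qs , refl with unique-⊆ {ys = ps ++ qs} uniq (λ x′∈ →
      [ ∈-++⁺ˡ , (λ { (here refl) → contradiction refl (All.lookup x∉ x′∈) ; (there q) → ∈-++⁺ʳ ps q }) ]′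
      (∈-++⁻ ps (⊆ys (there x′∈))))
...   | zs , perm = zs , ↭-trans (shift x ps qs) (↭-prep x perm)

unique-⊆-length : ∀ {A : Set} {xs ys : List A} → Unique xs → (∀ {x} → x ∈ xs → x ∈ ys) →
                  length xs ≤ length ys
unique-⊆-length {xs = xs} uniq xs⊆ys with unique-⊆ uniq xs⊆ys
... | zs , perm = ≤-trans (m≤m+n (length xs) (length zs))
  (≤-reflexive (trans (sym (length-++ xs)) (sym (↭-length perm))))

unique-⊆-↭ : ∀ {A : Set} {xs ys : List A} → Unique xs → (∀ {x} → x ∈ xs → x ∈ ys) →
             length xs ≡ length ys → xs ↭ ys
unique-⊆-↭ {xs = xs} uniq xs⊆ys len with unique-⊆ uniq xs⊆ys
... | []     , perm = ↭-sym (↭-trans perm (↭-reflexive (++-identityʳ xs)))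
... | z ∷ zs , perm = contradiction
  (trans len (trans (↭-length perm) (length-++ xs)))
  (m≢1+m+n (length xs) ∘ λ e → trans e (+-suc (length xs) (length zs)))

-- Lists what `count` counts, so that a count can be compared with other lengths through injections.
solutions : {P : Pred Word 0ℓ} → Decidable P → ℕ → List Word
solutions P? zero    = if does (P? []) then [] ∷ [] else []
solutions P? (suc n) = map (L ∷_) (solutions (P? ∘ (L ∷_)) n) ++ map (R ∷_) (solutions (P? ∘ (R ∷_)) n)

length-solutions : ∀ (P? : Decidable P) n → length (solutions P? n) ≡ count P? n
length-solutions P? zero with does (P? [])
... | true  = refl
... | false = refl
length-solutions P? (suc n) = trans
  (length-++ (map (L ∷_) (solutions (P? ∘ (L ∷_)) n)) {map (R ∷_) (solutions (P? ∘ (R ∷_)) n)})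
  (cong₂ _+_ (trans (length-map (L ∷_) (solutions (P? ∘ (L ∷_)) n)) (length-solutions (P? ∘ (L ∷_)) n))
             (trans (length-map (R ∷_) (solutions (P? ∘ (R ∷_)) n)) (length-solutions (P? ∘ (R ∷_)) n)))

∈-solutions⁺ : ∀ (P? : Decidable P) w → P w → w ∈ solutions P? (length w)
∈-solutions⁺ P? [] p with P? []
... | yes _ = here refl
... | no ¬p = contradiction p ¬p
∈-solutions⁺ P? (L ∷ w) p = ∈-++⁺ˡ (∈-map⁺ (L ∷_) (∈-solutions⁺ (P? ∘ (L ∷_)) w p))
∈-solutions⁺ P? (R ∷ w) p = ∈-++⁺ʳ (map (L ∷_) (solutions (P? ∘ (L ∷_)) (length w)))
  (∈-map⁺ (R ∷_) (∈-solutions⁺ (P? ∘ (R ∷_)) w p))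

∈-solutions⁻ : ∀ (P? : Decidable P) n {w} → w ∈ solutions P? n → P w × length w ≡ n
∈-solutions⁻ P? zero w∈ with P? []
∈-solutions⁻ P? zero (here refl) | yes p = p , refl
∈-solutions⁻ P? (suc n) w∈ with ∈-++⁻ (map (L ∷_) (solutions (P? ∘ (L ∷_)) n)) w∈
... | inj₁ L∈ with ∈-map⁻ (L ∷_) L∈
...   | w , w∈′ , refl = let p , len = ∈-solutions⁻ (P? ∘ (L ∷_)) n w∈′ in p , cong suc len
∈-solutions⁻ P? (suc n) w∈ | inj₂ R∈ with ∈-map⁻ (R ∷_) R∈
...   | w , w∈′ , refl = let p , len = ∈-solutions⁻ (P? ∘ (R ∷_)) n w∈′ in p , cong suc len

solutions-unique : ∀ (P? : Decidable P) n → Unique (solutions P? n)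
solutions-unique P? zero with does (P? [])
... | true  = [] ∷ []
... | false = []
solutions-unique P? (suc n) = Unique.++⁺
  (Unique.map⁺ ∷-injectiveʳ (solutions-unique (P? ∘ (L ∷_)) n))
  (Unique.map⁺ ∷-injectiveʳ (solutions-unique (P? ∘ (R ∷_)) n))
  λ { (L∈ , R∈) → disjoint (∈-map⁻ (L ∷_) L∈) (∈-map⁻ (R ∷_) R∈) }
  where
  disjoint : ∀ {w us vs} → ∃[ u ] u ∈ us × w ≡ L ∷ u → ∃[ v ] v ∈ vs × w ≡ R ∷ v → _
  disjoint (_ , _ , refl) (_ , _ , ())

-- Permutations as lists of values

values : ∀ {n} → Vec (Fin n) n → List ℕ
values π = tabulate (λ i → suc (toℕ (lookup π i)))

tabulate-injective : ∀ {A : Set} {n} {g h : Fin n → A} → tabulate g ≡ tabulate h → ∀ i → g i ≡ h i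
tabulate-injective eq zero    = ∷-injectiveˡ eq
tabulate-injective eq (suc i) = tabulate-injective (∷-injectiveʳ eq) i

unique-tabulate⁻ : ∀ {A : Set} {n} {g : Fin n → A} → Unique (tabulate g) →
                   ∀ {i j} → g i ≡ g j → i ≡ j
unique-tabulate⁻ _          {zero}  {zero}  eq = refl
unique-tabulate⁻ {g = g} (x∉ ∷ _) {zero} {suc j} eq =
  contradiction eq (All.lookup x∉ (∈-tabulate⁺ {f = g ∘ suc} j))
unique-tabulate⁻ {g = g} (x∉ ∷ _) {suc i} {zero} eq =
  contradiction (sym eq) (All.lookup x∉ (∈-tabulate⁺ {f = g ∘ suc} i))
unique-tabulate⁻ (_ ∷ uniq) {suc i} {suc j} eq = cong suc (unique-tabulate⁻ uniq eq)

tabulate-surjective : ∀ {A : Set} {n} (l : List A) → length l ≡ n → ∃[ g ] tabulate {n = n} g ≡ l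
tabulate-surjective l refl = List.lookup l , tabulate-lookup l

values-injective : ∀ {n} {π σ : Vec (Fin n) n} → values π ≡ values σ → π ≡ σ
values-injective {_} {π} {σ} eq = begin
  π                          ≡⟨ Vec.tabulate∘lookup π ⟨
  Vec.tabulate (lookup π)    ≡⟨ Vec.tabulate-cong (λ i → toℕ-injective (suc-injective (tabulate-injective eq i))) ⟩
  Vec.tabulate (lookup σ)    ≡⟨ Vec.tabulate∘lookup σ ⟩
  σ                          ∎
  where open ≡-Reasoning

-- Injectivity makes the values distinct members of `range 1 n`, and equal lengths make them all of
-- it. Conversely, distinctness gives injectivity and membership gives surjectivity.
permutation⇔↭ : ∀ {n} (π : Vec (Fin (suc n)) (suc n)) → IsPermutation π ⇔ (values π ↭ range 1 n)
permutation⇔↭ {n} π = mk⇔ forth back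
  where
  forth : IsPermutation π → values π ↭ range 1 n
  forth (inj , _) = unique-⊆-↭
    (Unique.tabulate⁺ (inj ∘ toℕ-injective ∘ suc-injective))
    (λ x∈ → let i , eq = ∈-tabulate⁻ {f = λ i → suc (toℕ (lookup π i))} x∈ in subst (_∈ range 1 n) (sym eq)
      (∈-range⁺ 1 n (s≤s z≤n) (toℕ<n (lookup π i))))
    (trans (length-tabulate (λ i → suc (toℕ (lookup π i)))) (sym (length-range 1 n)))

  back : values π ↭ range 1 n → IsPermutation π
  back perm = injective , λ y →
    let i , eq = ∈-tabulate⁻ {f = λ i → suc (toℕ (lookup π i))}
          (∈-resp-↭ (↭-sym perm) (∈-range⁺ 1 n (s≤s z≤n) (toℕ<n y)))
    in i , λ { refl → sym (toℕ-injective (suc-injective eq)) }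
    where
    injective : ∀ {i j} → lookup π i ≡ lookup π j → i ≡ j
    injective eq = unique-tabulate⁻ (unique-resp-↭ (↭-sym perm) (range-unique 1 n))
      (cong (suc ∘ toℕ) eq)

↭⇒values : ∀ {n} l → l ↭ range 1 n → ∃[ π ] values {suc n} π ≡ l
↭⇒values {n} l perm with tabulate-surjective l (trans (↭-length perm) (length-range 1 n))
... | g , refl = Vec.tabulate entry , tabulate-cong λ i →
  trans (cong (suc ∘ toℕ) (Vec.lookup∘tabulate entry i)) (suc-entry i)
  where
  bounds : ∀ i → 1 ≤ g i × g i ≤ suc n
  bounds i = ∈-range⁻ 1 n (∈-resp-↭ perm (∈-tabulate⁺ {f = g} i))

  pred<n : ∀ i → pred (g i) < suc n
  pred<n i = ≤-trans (≤-reflexive (suc-pred (g i) {{>-nonZero (proj₁ (bounds i))}})) (proj₂ (bounds i))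

  entry : Fin (suc n) → Fin (suc n)
  entry i = fromℕ< (pred<n i)

  suc-entry : ∀ i → suc (toℕ (entry i)) ≡ g i
  suc-entry i = trans (cong suc (toℕ-fromℕ< (pred<n i))) (suc-pred (g i) {{>-nonZero (proj₁ (bounds i))}})

ConvexAt : ∀ {n} → ℕ → (Fin n → ℕ) → Set
ConvexAt {n} k g = ∀ (h i j : Fin n) → toℕ i ≡ suc (toℕ h) → toℕ j ≡ suc (toℕ i) →
  g h + g j ≤ k + (g i + g i)

convexAt⇔convex : ∀ {n k} (g : Fin n → ℕ) → ConvexAt k g ⇔ Convex k (tabulate g)
convexAt⇔convex g = mk⇔ (forth g) (back g)
  where
  forth : ∀ {n k} (g : Fin n → ℕ) → ConvexAt k g → Convex k (tabulate g)
  forth {zero}  g c = tt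
  forth {suc n} {k} g c = first g c , forth (g ∘ suc) λ h i j e₁ e₂ →
    c (suc h) (suc i) (suc j) (cong suc e₁) (cong suc e₂)
    where
    first : ∀ {n} (g : Fin (suc n) → ℕ) → ConvexAt k g → FirstStep k (g zero) (tabulate (g ∘ suc))
    first {zero}        g c = tt
    first {suc zero}    g c = tt
    first {suc (suc n)} g c = c zero (suc zero) (suc (suc zero)) refl refl

  back : ∀ {n k} (g : Fin n → ℕ) → Convex k (tabulate g) → ConvexAt k g
  back g (c , _) zero    (suc zero) (suc (suc zero)) e₁ e₂ = c
  back g (_ , c) (suc h) (suc i)    (suc j)          e₁ e₂ =
    back (g ∘ suc) c h i j (suc-injective e₁) (suc-injective e₂)

isConvex⇔convex : ∀ {n k} (π : Vec (Fin n) n) → IsConvex k π ⇔ Convex k (values π)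
isConvex⇔convex {n} {k} π = mk⇔
  (λ c → to (convexAt⇔convex v) λ h i j e₁ e₂ → forth (v h) (v i) (v j) (c h i j e₁ e₂))
  (λ c h i j e₁ e₂ → back (v h) (v i) (v j) (from (convexAt⇔convex v) c h i j e₁ e₂))
  where
  v : Fin n → ℕ
  v i = suc (toℕ (lookup π i))

  double : ∀ b → ℤ.+ 2 ℤ.* ℤ.+ b ≡ ℤ.+ (b + b)
  double b = trans (sym (ℤ.pos-* 2 b)) (cong (λ c → ℤ.+ (b + c)) (+-identityʳ b))

  forth : ∀ a b c → ℤ.+ a ℤ.+ ℤ.+ c ℤ.- ℤ.+ 2 ℤ.* ℤ.+ b ℤ.≤ ℤ.+ k → a + c ≤ k + (b + b)
  forth a b c le = ℤ.drop‿+≤+ (ℤ.≤-trans (ℤ.≤-reflexive (undo (ℤ.+ (a + c)) (ℤ.+ (b + b))))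
    (ℤ.+-monoˡ-≤ (ℤ.+ (b + b)) (subst (λ d → ℤ.+ (a + c) ℤ.- d ℤ.≤ ℤ.+ k) (double b) le)))
    where
    undo : ∀ x y → x ≡ x ℤ.- y ℤ.+ y
    undo = ℤ-solve-∀

  back : ∀ a b c → a + c ≤ k + (b + b) → ℤ.+ a ℤ.+ ℤ.+ c ℤ.- ℤ.+ 2 ℤ.* ℤ.+ b ℤ.≤ ℤ.+ k
  back a b c le = subst (λ d → ℤ.+ (a + c) ℤ.- d ℤ.≤ ℤ.+ k) (sym (double b))
    (ℤ.≤-trans (ℤ.+-monoˡ-≤ (ℤ.- (ℤ.+ (b + b))) (ℤ.+≤+ le))
      (ℤ.≤-reflexive (undo (ℤ.+ k) (ℤ.+ (b + b)))))
    where
    undo : ∀ x y → x ℤ.+ y ℤ.- y ≡ x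
    undo = ℤ-solve-∀

-- Through `values` and `build 1`, permutations and valid words become lists of numbers without
-- repetitions, and the two collections coincide. The least value is placed last into every
-- arrangement and needs no letter when it is alone, so words are one shorter than permutations.
f≡words : ∀ {k} → k ≤ 2 → ∀ n → f k (suc n) ≡ count (valid? k) n
f≡words {k} k≤2 n = begin
  length perms                     ≡⟨ length-map values perms ⟨
  length (map values perms)        ≡⟨ ≤-antisym
      (unique-⊆-length (Unique.map⁺ values-injective
        (Unique.filter⁺ good? (words-unique (suc n) (suc n)))) encode)
      (unique-⊆-length (Unique.map⁺ build-injective (solutions-unique (valid? k) n)) decode) ⟩
  length (map (build 1) valids)    ≡⟨ length-map (build 1) valids ⟩
  length valids                    ≡⟨ length-solutions (valid? k) n ⟩
  count (valid? k) n               ∎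
  where
  open ≡-Reasoning
  good? : ∀ π → Dec (IsPermutation π × IsConvex k π)
  good? π = isPermutation? π ×-dec isConvex? k π
  perms = filter good? (words (suc n) (suc n))
  valids = solutions (valid? k) n

  encode : ∀ {l} → l ∈ map values perms → l ∈ map (build 1) valids
  encode l∈ with ∈-map⁻ values l∈
  ... | π , π∈ , refl with ∈-filter⁻ good? {xs = words (suc n) (suc n)} π∈
  ...   | _ , perm , conv with convex⇒build k≤2 n 1 (values π)
                                 (to (permutation⇔↭ π) perm) (to (isConvex⇔convex π) conv)
  ...     | w , refl , eq = subst (_∈ map (build 1) valids) (sym eq) (∈-map⁺ (build 1)
    (∈-solutions⁺ (valid? k) w (from (valid⇔convex 1 w) (subst (Convex k) eq (to (isConvex⇔convex π) conv)))))

  decode : ∀ {l} → l ∈ map (build 1) valids → l ∈ map values perms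
  decode l∈ with ∈-map⁻ (build 1) l∈
  ... | w , w∈ , refl with ∈-solutions⁻ (valid? k) n w∈
  ...   | valid , refl with ↭⇒values (build 1 w) (build-↭ 1 w)
  ...     | π , eq = subst (_∈ map values perms) eq (∈-map⁺ values
    (∈-filter⁺ good? (words-complete π)
    ( from (permutation⇔↭ π) (subst (_↭ range 1 (length w)) (sym eq) (build-↭ 1 w))
    , from (isConvex⇔convex π) (subst (Convex k) (sym eq) (to (valid⇔convex 1 w) valid)))))

-- Growth rates

^-distribʳ-* : ∀ m n o → (m * n) ^ o ≡ m ^ o * n ^ o
^-distribʳ-* m n zero    = refl
^-distribʳ-* m n (suc o) =
  trans (cong (m * n *_) (^-distribʳ-* m n o)) (lemma m n (m ^ o) (n ^ o))
  where
  lemma : ∀ a b c d → a * b * (c * d) ≡ a * c * (b * d)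
  lemma = solve-∀

^-comm : ∀ a m n → (a ^ m) ^ n ≡ (a ^ n) ^ m
^-comm a m n = trans (^-*-assoc a m n) (trans (cong (a ^_) (*-comm m n)) (sym (^-*-assoc a n m)))

^-cancelʳ-≤ : ∀ {a b} n .{{_ : NonZero n}} → a ^ n ≤ b ^ n → a ≤ b
^-cancelʳ-≤ n aⁿ≤bⁿ = ≮⇒≥ λ b<a → <⇒≱ (^-monoˡ-< n b<a) aⁿ≤bⁿ

-- The rounded-down root, found by induction on x: a step in x raises it by at most one.
integer-root : ∀ n .{{_ : NonZero n}} x → ∃[ a ] a ^ n ≤ x × x < suc a ^ n
integer-root n@(suc _) zero = 0 , z≤n , ≤-reflexive (sym (^-zeroˡ n))
integer-root n (suc x) with integer-root n x
... | a , aⁿ≤x , x<a⁺ⁿ with suc a ^ n ≤? suc x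
...   | yes a⁺ⁿ≤ = suc a , a⁺ⁿ≤ , ≤-<-trans x<a⁺ⁿ (^-monoˡ-< n (n<1+n (suc a)))
...   | no  a⁺ⁿ≰ = a , m≤n⇒m≤1+n aⁿ≤x , ≰⇒> a⁺ⁿ≰

-- Bernoulli's inequality 1 + n(y/x) ≤ (1 + y/x)^n with denominators cleared.
bernoulli : ∀ x y n → x ^ n * (x + n * y) ≤ (x + y) ^ n * x
bernoulli x y zero    = ≤-reflexive (cong (1 *_) (+-identityʳ x))
bernoulli x y (suc n) = begin
  x * x ^ n * (x + (y + n * y))                         ≤⟨ m≤m+n _ (x ^ n * (n * y * y)) ⟩
  x * x ^ n * (x + (y + n * y)) + x ^ n * (n * y * y)   ≡⟨ expand x y n (x ^ n) ⟩
  (x + y) * (x ^ n * (x + n * y))                       ≤⟨ *-monoʳ-≤ (x + y) (bernoulli x y n) ⟩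
  (x + y) * ((x + y) ^ n * x)                           ≡⟨ *-assoc (x + y) _ x ⟨
  (x + y) * (x + y) ^ n * x                             ∎
  where
  open ≤-Reasoning
  expand : ∀ x y n p → x * p * (x + (y + n * y)) + p * (n * y * y) ≡ (x + y) * (p * (x + n * y))
  expand = solve-∀

bernoulli-1 : ∀ n .{{_ : NonZero n}} y → n ^ n * suc y ≤ (n + y) ^ n
bernoulli-1 n y = *-cancelʳ-≤ _ _ n (begin
  n ^ n * suc y * n        ≡⟨ shuffle n y (n ^ n) ⟩
  n ^ n * (n + n * y)      ≤⟨ bernoulli n y n ⟩
  (n + y) ^ n * n          ∎)
  where
  open ≤-Reasoning
  shuffle : ∀ n y p → p * suc y * n ≡ p * (n + n * y)
  shuffle = solve-∀

-- For positive c this is (1 + 1/a)^n ≤ 1/(1 - n/a). The induction rests on (a + 1)c ≤ (c + 1)a,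
-- that is, c ≤ a.
reverse-bernoulli : ∀ a n c → n + c ≡ a → suc a ^ n * c ≤ a ^ n * a
reverse-bernoulli a zero    c refl = ≤-refl
reverse-bernoulli a (suc n) c eq   = begin
  suc a * suc a ^ n * c        ≡⟨ rotate (suc a) (suc a ^ n) c ⟩
  suc a ^ n * (suc a * c)      ≤⟨ *-monoʳ-≤ (suc a ^ n) step ⟩
  suc a ^ n * (suc c * a)      ≡⟨ *-assoc (suc a ^ n) (suc c) a ⟨
  suc a ^ n * suc c * a        ≤⟨ *-monoˡ-≤ a (reverse-bernoulli a n (suc c) (trans (+-suc n c) eq)) ⟩
  a ^ n * a * a                ≡⟨ cong (_* a) (*-comm (a ^ n) a) ⟩
  a * a ^ n * a                ∎
  where
  open ≤-Reasoning
  rotate : ∀ x y z → x * y * z ≡ y * (x * z)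
  rotate = solve-∀

  step : suc a * c ≤ suc c * a
  step = ≤-trans (+-monoˡ-≤ (a * c) (≤-trans (m≤n+m c (suc n)) (≤-reflexive eq)))
    (≤-reflexive (cong (a +_) (*-comm a c)))

suc-^-≤ : ∀ a n .{{_ : NonZero n}} → 2 * n ≤ a → suc a ^ n ≤ 2 * a ^ n
suc-^-≤ a n@(suc _) 2n≤a = *-cancelʳ-≤ _ _ a {{>-nonZero (≤-trans (s≤s z≤n) 2n≤a)}} (begin
  suc a ^ n * a            ≤⟨ *-monoʳ-≤ (suc a ^ n) a≤2c ⟩
  suc a ^ n * (2 * c)      ≡⟨ rotate (suc a ^ n) c ⟩
  2 * (suc a ^ n * c)      ≤⟨ *-monoʳ-≤ 2 (reverse-bernoulli a n c n+c≡a) ⟩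
  2 * (a ^ n * a)          ≡⟨ *-assoc 2 (a ^ n) a ⟨
  2 * a ^ n * a            ∎)
  where
  open ≤-Reasoning
  n+n≤a : n + n ≤ a
  n+n≤a = subst (_≤ a) (cong (n +_) (+-identityʳ n)) 2n≤a

  c = a ∸ n

  n+c≡a : n + c ≡ a
  n+c≡a = m+[n∸m]≡n (≤-trans (m≤m+n n n) n+n≤a)

  a≤2c : a ≤ 2 * c
  a≤2c = subst₂ _≤_ n+c≡a (cong (c +_) (sym (+-identityʳ c)))
    (+-monoˡ-≤ c (+-cancelˡ-≤ n n c (subst (n + n ≤_) (sym n+c≡a) n+n≤a)))

  rotate : ∀ x c → x * (2 * c) ≡ 2 * (x * c)
  rotate = solve-∀

-- Inequalities between fractions

frac : ∀ a d .{{_ : NonZero d}} → ℚ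
frac a d = ℤ.+ a ℚ./ d

toℚᵘ-frac : ∀ a d → ℚ.toℚᵘ (frac a (suc d)) ℚᵘ.≃ mkℚᵘ (ℤ.+ a) d
toℚᵘ-frac a d = ℚ.toℚᵘ-fromℚᵘ (mkℚᵘ (ℤ.+ a) d)

mkℚᵘ-≤ : ∀ {a b d e} → a * suc e ≤ b * suc d → mkℚᵘ (ℤ.+ a) d ℚᵘ.≤ mkℚᵘ (ℤ.+ b) e
mkℚᵘ-≤ {a} {b} {d} {e} le = ℚᵘ.*≤* (subst₂ ℤ._≤_ (ℤ.pos-* a (suc e)) (ℤ.pos-* b (suc d)) (ℤ.+≤+ le))

frac-≤ : ∀ a b d e .{{_ : NonZero d}} .{{_ : NonZero e}} → a * e ≤ b * d → frac a d ℚ.≤ frac b e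
frac-≤ a b (suc d) (suc e) le = ℚ.toℚᵘ-cancel-≤ (begin
  ℚ.toℚᵘ (frac a (suc d))    ≃⟨ toℚᵘ-frac a d ⟩
  mkℚᵘ (ℤ.+ a) d             ≤⟨ mkℚᵘ-≤ le ⟩
  mkℚᵘ (ℤ.+ b) e             ≃⟨ toℚᵘ-frac b e ⟨
  ℚ.toℚᵘ (frac b (suc e))    ∎)
  where open ℚᵘ.≤-Reasoning

frac-≤-+ : ∀ a b c d e t .{{_ : NonZero d}} .{{_ : NonZero e}} .{{_ : NonZero t}} →
           a * (e * t) ≤ (b * t + c * e) * d → frac a d ℚ.≤ frac b e ℚ.+ frac c t
frac-≤-+ a b c (suc d) (suc e) (suc t) le = ℚ.toℚᵘ-cancel-≤ (begin
  ℚ.toℚᵘ (frac a (suc d))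
    ≃⟨ toℚᵘ-frac a d ⟩
  mkℚᵘ (ℤ.+ a) d
    ≤⟨ mkℚᵘ-≤ le ⟩
  mkℚᵘ (ℤ.+ (b * suc t + c * suc e)) (t + e * suc t)
    ≡⟨ cong (λ i → mkℚᵘ i (t + e * suc t)) (cong₂ ℤ._+_ (ℤ.pos-* b (suc t)) (ℤ.pos-* c (suc e))) ⟩
  mkℚᵘ (ℤ.+ b) e ℚᵘ.+ mkℚᵘ (ℤ.+ c) t
    ≃⟨ ℚᵘ.+-cong (toℚᵘ-frac b e) (toℚᵘ-frac c t) ⟨
  ℚ.toℚᵘ (frac b (suc e)) ℚᵘ.+ ℚ.toℚᵘ (frac c (suc t))
    ≃⟨ ℚ.toℚᵘ-homo-+ (frac b (suc e)) (frac c (suc t)) ⟨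
  ℚ.toℚᵘ (frac b (suc e) ℚ.+ frac c (suc t)) ∎)
  where open ℚᵘ.≤-Reasoning

frac-* : ∀ a b d e .{{_ : NonZero d}} .{{_ : NonZero e}} →
         frac a d ℚ.* frac b e ≡ frac (a * b) (d * e) {{m*n≢0 d e}}
frac-* a b (suc d) (suc e) = ℚ.toℚᵘ-injective (begin
  ℚ.toℚᵘ (frac a (suc d) ℚ.* frac b (suc e))
    ≈⟨ ℚ.toℚᵘ-homo-* (frac a (suc d)) (frac b (suc e)) ⟩
  ℚ.toℚᵘ (frac a (suc d)) ℚᵘ.* ℚ.toℚᵘ (frac b (suc e))
    ≈⟨ ℚᵘ.*-cong (toℚᵘ-frac a d) (toℚᵘ-frac b e) ⟩
  mkℚᵘ (ℤ.+ a) d ℚᵘ.* mkℚᵘ (ℤ.+ b) e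
    ≡⟨ cong (λ i → mkℚᵘ i (e + d * suc e)) (ℤ.pos-* a b) ⟨
  mkℚᵘ (ℤ.+ (a * b)) (e + d * suc e)
    ≈⟨ toℚᵘ-frac (a * b) (e + d * suc e) ⟨
  ℚ.toℚᵘ (frac (a * b) (suc d * suc e)) ∎)
  where open import Relation.Binary.Reasoning.Setoid ℚᵘ.≃-setoid

archimedean : ∀ e ε → 0ℚ ℚ.< ε → ∃[ t ] frac e (suc t) ℚ.≤ ε
archimedean e ε@(mkℚ ℤ.-[1+ _ ] _ _)   0<ε with ℚ.positive 0<ε
... | ()
archimedean e ε@(mkℚ (ℤ.+ zero) _ _)   0<ε with ℚ.positive 0<ε
... | ()
-- With denominator (d + 1)(e + 1) the fraction is below 1/(d + 1), hence below ε = (p + 1)/(d + 1).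
archimedean e ε@(mkℚ (ℤ.+ suc p) d _) 0<ε = e + d * suc e , ℚ.toℚᵘ-cancel-≤ (begin
  ℚ.toℚᵘ (frac e (suc d * suc e))    ≃⟨ toℚᵘ-frac e (e + d * suc e) ⟩
  mkℚᵘ (ℤ.+ e) (e + d * suc e)       ≤⟨ mkℚᵘ-≤ (≤-trans le (m≤m+n (suc d * suc e) _)) ⟩
  mkℚᵘ (ℤ.+ suc p) d                 ∎)
  where
  open ℚᵘ.≤-Reasoning
  le : e * suc d ≤ suc d * suc e
  le = ≤-trans (≤-reflexive (*-comm e (suc d))) (*-monoʳ-≤ (suc d) (n≤1+n e))

∣p-q∣≤r : ∀ {p q r} → p ℚ.≤ q ℚ.+ r → q ℚ.≤ p ℚ.+ r → ℚ.∣ p ℚ.- q ∣ ℚ.≤ r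
∣p-q∣≤r {p} {q} {r} p≤q+r q≤p+r with ℚ.∣p∣≡p∨∣p∣≡-p (p ℚ.- q)
... | inj₁ eq = subst (ℚ._≤ r) (sym eq) (move p≤q+r)
  where
  open +-*-Solver
  move : ∀ {p q} → p ℚ.≤ q ℚ.+ r → p ℚ.- q ℚ.≤ r
  move {p} {q} le = ℚ.≤-trans (ℚ.+-monoˡ-≤ (ℚ.- q) le)
    (ℚ.≤-reflexive (solve 2 (λ q r → q :+ r :- q := r) refl q r))
... | inj₂ eq = subst (ℚ._≤ r) (sym (trans eq (solve 2 (λ p q → :- (p :- q) := q :- p) refl p q)))
  (ℚ.≤-trans (ℚ.+-monoˡ-≤ (ℚ.- p) q≤p+r)
    (ℚ.≤-reflexive (solve 2 (λ q r → q :+ r :- q := r) refl p r)))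
  where open +-*-Solver

p≤q⇒p≤q+ε : ∀ {p q ε} → 0ℚ ℚ.< ε → p ℚ.≤ q → p ℚ.≤ q ℚ.+ ε
p≤q⇒p≤q+ε {p} {q} {ε} 0<ε p≤q =
  subst (ℚ._≤ q ℚ.+ ε) (ℚ.+-identityʳ p) (ℚ.+-mono-≤ p≤q (ℚ.<⇒≤ 0<ε))

-- The growth rate of a quasimultiplicative function

module Quasimultiplicative
  (g : ℕ → ℕ) (K : ℕ)
  (g>0 : ∀ n → 1 ≤ g n)
  (g-zero : g 0 ≡ 1)
  (submult : ∀ m n → g (m + n) ≤ g m * g n)
  (supermult : ∀ m n → g m * g n ≤ g (m + n) * K)
  where

  open ≤-Reasoning

  private
    instance
      g-nonZero : ∀ {n} → NonZero (g n)
      g-nonZero {n} = >-nonZero (g>0 n)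

  K>0 : 1 ≤ K
  K>0 = ≤-trans (subst₂ (λ x y → x ≤ y * K) (cong₂ _*_ g-zero g-zero) g-zero (supermult 0 0))
    (≤-reflexive (*-identityˡ K))

  instance
    K-nonZero : NonZero K
    K-nonZero = >-nonZero K>0

  g-*-≤-^ : ∀ n m → g (n * m) ≤ g m ^ n
  g-*-≤-^ zero    m = ≤-reflexive g-zero
  g-*-≤-^ (suc n) m = ≤-trans (submult m (n * m)) (*-monoʳ-≤ (g m) (g-*-≤-^ n m))

  g-^-≤-* : ∀ n m → g m ^ n ≤ g (n * m) * K ^ n
  g-^-≤-* zero    m = ≤-trans (g>0 0) (≤-reflexive (sym (*-identityʳ (g 0))))
  g-^-≤-* (suc n) m = begin
    g m * g m ^ n                   ≤⟨ *-monoʳ-≤ (g m) (g-^-≤-* n m) ⟩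
    g m * (g (n * m) * K ^ n)       ≡⟨ *-assoc (g m) _ _ ⟨
    g m * g (n * m) * K ^ n         ≤⟨ *-monoˡ-≤ (K ^ n) (supermult m (n * m)) ⟩
    g (m + n * m) * K * K ^ n       ≡⟨ *-assoc (g (m + n * m)) K _ ⟩
    g (suc n * m) * K ^ suc n       ∎

  -- Both powers are compared with g(mn). For positive m and n it means that g(n)^(1/n) is at most
  -- g(m)^(1/m) K^(1/n).
  g-^-swap : ∀ m n → g n ^ m ≤ g m ^ n * K ^ m
  g-^-swap m n = begin
    g n ^ m              ≤⟨ g-^-≤-* m n ⟩
    g (m * n) * K ^ m    ≡⟨ cong (λ l → g l * K ^ m) (*-comm m n) ⟩
    g (n * m) * K ^ m    ≤⟨ *-monoˡ-≤ (K ^ m) (g-*-≤-^ n m) ⟩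
    g m ^ n * K ^ m      ∎

  -- num m / den m approximates the (m+1)-st root of g (m + 1).
  den : ℕ → ℕ
  den m = 2 * suc m

  opaque
    num : ℕ → ℕ
    num m = proj₁ (integer-root (suc m) (g (suc m) * den m ^ suc m))

    num-^-≤ : ∀ m → num m ^ suc m ≤ g (suc m) * den m ^ suc m
    num-^-≤ m = proj₁ (proj₂ (integer-root (suc m) (g (suc m) * den m ^ suc m)))

    <-suc-num-^ : ∀ m → g (suc m) * den m ^ suc m < suc (num m) ^ suc m
    <-suc-num-^ m = proj₂ (proj₂ (integer-root (suc m) (g (suc m) * den m ^ suc m)))

  den≤num : ∀ m → den m ≤ num m
  den≤num m = ≮⇒≥ λ num<den → <⇒≱ (<-suc-num-^ m) (begin
    suc (num m) ^ suc m           ≤⟨ ^-monoˡ-≤ (suc m) num<den ⟩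
    den m ^ suc m                 ≤⟨ m≤n*m (den m ^ suc m) (g (suc m)) ⟩
    g (suc m) * den m ^ suc m     ∎)

  -- The denominator 2(m + 1) is chosen for this: the numerator is at least as large, so by
  -- `suc-^-≤` rounding the root down costs at most a factor 2 in the power.
  ≤-num-^ : ∀ m → g (suc m) * den m ^ suc m ≤ 2 * num m ^ suc m
  ≤-num-^ m = ≤-trans (<⇒≤ (<-suc-num-^ m)) (suc-^-≤ (num m) (suc m) (den≤num m))

  num≤den : ∀ m → num m ≤ g 1 * den m
  num≤den m = ^-cancelʳ-≤ (suc m) (begin
    num m ^ suc m                     ≤⟨ num-^-≤ m ⟩
    g (suc m) * den m ^ suc m         ≡⟨ cong (λ l → g l * den m ^ suc m) (*-identityʳ (suc m)) ⟨
    g (suc m * 1) * den m ^ suc m     ≤⟨ *-monoˡ-≤ (den m ^ suc m) (g-*-≤-^ (suc m) 1) ⟩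
    g 1 ^ suc m * den m ^ suc m       ≡⟨ ^-distribʳ-* (g 1) (den m) (suc m) ⟨
    (g 1 * den m) ^ suc m             ∎)

  private
    ^-^-≤ : ∀ m n → num m ^ suc m ≤ g (suc m) * den m ^ suc m →
            (num m ^ n) ^ suc m ≤ g (suc m) ^ n * (den m ^ n) ^ suc m
    ^-^-≤ m n le = begin
      (num m ^ n) ^ suc m                       ≡⟨ ^-comm (num m) n (suc m) ⟩
      (num m ^ suc m) ^ n                       ≤⟨ ^-monoˡ-≤ n le ⟩
      (g (suc m) * den m ^ suc m) ^ n           ≡⟨ ^-distribʳ-* (g (suc m)) _ n ⟩
      g (suc m) ^ n * (den m ^ suc m) ^ n       ≡⟨ cong (g (suc m) ^ n *_) (^-comm (den m) (suc m) n) ⟩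
      g (suc m) ^ n * (den m ^ n) ^ suc m       ∎

    ≥-^-^ : ∀ m n → g (suc m) ^ n * (den m ^ n) ^ suc m ≤ 2 ^ n * (num m ^ n) ^ suc m
    ≥-^-^ m n = begin
      g (suc m) ^ n * (den m ^ n) ^ suc m       ≡⟨ cong (g (suc m) ^ n *_) (^-comm (den m) n (suc m)) ⟩
      g (suc m) ^ n * (den m ^ suc m) ^ n       ≡⟨ ^-distribʳ-* (g (suc m)) _ n ⟨
      (g (suc m) * den m ^ suc m) ^ n           ≤⟨ ^-monoˡ-≤ n (≤-num-^ m) ⟩
      (2 * num m ^ suc m) ^ n                   ≡⟨ ^-distribʳ-* 2 _ n ⟩
      2 ^ n * (num m ^ suc m) ^ n               ≡⟨ cong (2 ^ n *_) (^-comm (num m) (suc m) n) ⟩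
      2 ^ n * (num m ^ n) ^ suc m               ∎

  -- After raising to the power m + 1, `g-^-swap` applies, and n ≤ m + 1 absorbs `K ^ n`, in `upper`
  -- likewise `2 ^ n`, into constants independent of m. Letting m grow with n fixed gives both
  -- halves of the Θ-estimate.
  lower : ∀ n m → n ≤ suc m → num m ^ n ≤ K * g n * den m ^ n
  lower n m n≤ = ^-cancelʳ-≤ (suc m) (begin
    (num m ^ n) ^ suc m
      ≤⟨ ^-^-≤ m n (num-^-≤ m) ⟩
    g (suc m) ^ n * (den m ^ n) ^ suc m
      ≤⟨ *-monoˡ-≤ _ (g-^-swap n (suc m)) ⟩
    g n ^ suc m * K ^ n * (den m ^ n) ^ suc m
      ≤⟨ *-monoˡ-≤ _ (*-monoʳ-≤ (g n ^ suc m) (^-monoʳ-≤ K n≤)) ⟩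
    g n ^ suc m * K ^ suc m * (den m ^ n) ^ suc m
      ≡⟨ cong (_* (den m ^ n) ^ suc m) (trans (*-comm (g n ^ suc m) _) (sym (^-distribʳ-* K (g n) (suc m)))) ⟩
    (K * g n) ^ suc m * (den m ^ n) ^ suc m
      ≡⟨ ^-distribʳ-* (K * g n) _ (suc m) ⟨
    (K * g n * den m ^ n) ^ suc m ∎)

  upper : ∀ n m → n ≤ suc m → g n * den m ^ n ≤ 2 * K * num m ^ n
  upper n m n≤ = ^-cancelʳ-≤ (suc m) (begin
    (g n * den m ^ n) ^ suc m
      ≡⟨ ^-distribʳ-* (g n) _ (suc m) ⟩
    g n ^ suc m * (den m ^ n) ^ suc m
      ≤⟨ *-monoˡ-≤ _ (g-^-swap (suc m) n) ⟩
    g (suc m) ^ n * K ^ suc m * (den m ^ n) ^ suc m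
      ≡⟨ rotate (g (suc m) ^ n) _ _ ⟩
    K ^ suc m * (g (suc m) ^ n * (den m ^ n) ^ suc m)
      ≤⟨ *-monoʳ-≤ (K ^ suc m) (≥-^-^ m n) ⟩
    K ^ suc m * (2 ^ n * (num m ^ n) ^ suc m)
      ≤⟨ *-monoʳ-≤ (K ^ suc m) (*-monoˡ-≤ _ (^-monoʳ-≤ 2 n≤)) ⟩
    K ^ suc m * (2 ^ suc m * (num m ^ n) ^ suc m)
      ≡⟨ *-assoc (K ^ suc m) _ _ ⟨
    K ^ suc m * 2 ^ suc m * (num m ^ n) ^ suc m
      ≡⟨ cong (_* (num m ^ n) ^ suc m) (trans (*-comm (K ^ suc m) _) (sym (^-distribʳ-* 2 K (suc m)))) ⟩
    (2 * K) ^ suc m * (num m ^ n) ^ suc m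
      ≡⟨ ^-distribʳ-* (2 * K) _ (suc m) ⟨
    (2 * K * num m ^ n) ^ suc m ∎)
    where
    rotate : ∀ a b c → a * b * c ≡ b * (a * c)
    rotate = solve-∀

  -- The ratio of two approximations is at most K^(1/N) 2^(1/M), which Bernoulli's
  -- inequality bounds by (1 + K/N) (1 + 1/M).
  ratio : ∀ m n → let M = suc m; N = suc n in
          num n * den m * (N * M) ≤ (N + K) * (M + 1) * (num m * den n)
  ratio m n = ^-cancelʳ-≤ M (^-cancelʳ-≤ N (begin
    ((num n * den m * (N * M)) ^ M) ^ N
      ≡⟨ left (num n) (den m) N M M N ⟩
    (num n ^ M) ^ N * (den m ^ N) ^ M * ((N ^ N) ^ M * (M ^ M) ^ N)
      ≤⟨ *-monoˡ-≤ _ (begin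
        (num n ^ M) ^ N * (den m ^ N) ^ M
          ≤⟨ *-monoˡ-≤ _ (^-^-≤ n M (num-^-≤ n)) ⟩
        g N ^ M * (den n ^ M) ^ N * (den m ^ N) ^ M
          ≤⟨ *-monoˡ-≤ _ (*-monoˡ-≤ _ (g-^-swap M N)) ⟩
        g M ^ N * K ^ M * (den n ^ M) ^ N * (den m ^ N) ^ M
          ≡⟨ rotate (g M ^ N) (K ^ M) _ _ ⟩
        K ^ M * (den n ^ M) ^ N * (g M ^ N * (den m ^ N) ^ M)
          ≤⟨ *-monoʳ-≤ (K ^ M * (den n ^ M) ^ N) (≥-^-^ m N) ⟩
        K ^ M * (den n ^ M) ^ N * (2 ^ N * (num m ^ N) ^ M) ∎) ⟩
    K ^ M * (den n ^ M) ^ N * (2 ^ N * (num m ^ N) ^ M) * ((N ^ N) ^ M * (M ^ M) ^ N)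
      ≡⟨ regroup (K ^ M) _ (2 ^ N) _ ((N ^ N) ^ M) ((M ^ M) ^ N) ⟩
    (N ^ N) ^ M * K ^ M * ((M ^ M) ^ N * 2 ^ N) * ((num m ^ N) ^ M * (den n ^ M) ^ N)
      ≡⟨ cong (_* ((num m ^ N) ^ M * (den n ^ M) ^ N))
           (cong₂ _*_ (^-distribʳ-* (N ^ N) K M) (^-distribʳ-* (M ^ M) 2 N)) ⟨
    (N ^ N * K) ^ M * (M ^ M * 2) ^ N * ((num m ^ N) ^ M * (den n ^ M) ^ N)
      ≤⟨ *-monoˡ-≤ _ (*-mono-≤
           (^-monoˡ-≤ M (≤-trans (*-monoʳ-≤ (N ^ N) (n≤1+n K)) (bernoulli-1 N K)))
           (^-monoˡ-≤ N (bernoulli-1 M 1))) ⟩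
    ((N + K) ^ N) ^ M * ((M + 1) ^ M) ^ N * ((num m ^ N) ^ M * (den n ^ M) ^ N)
      ≡⟨ right (N + K) (M + 1) (num m) (den n) M N ⟨
    (((N + K) * (M + 1) * (num m * den n)) ^ M) ^ N ∎))
    where
    M = suc m
    N = suc n

    rotate : ∀ a b c d → a * b * c * d ≡ b * c * (a * d)
    rotate = solve-∀

    regroup : ∀ k d t a x y → k * d * (t * a) * (x * y) ≡ x * k * (y * t) * (a * d)
    regroup = solve-∀

    split : ∀ a b M N → ((a * b) ^ M) ^ N ≡ (a ^ M) ^ N * (b ^ M) ^ N
    split a b M N = trans (cong (_^ N) (^-distribʳ-* a b M)) (^-distribʳ-* (a ^ M) (b ^ M) N)

    left : ∀ a b c d M N → ((a * b * (c * d)) ^ M) ^ N ≡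
           (a ^ M) ^ N * (b ^ N) ^ M * ((c ^ N) ^ M * (d ^ M) ^ N)
    left a b c d M N = trans (split (a * b) (c * d) M N) (cong₂ _*_
      (trans (split a b M N) (cong ((a ^ M) ^ N *_) (^-comm b M N)))
      (trans (split c d M N) (cong (_* (d ^ M) ^ N) (^-comm c M N))))

    right : ∀ a b c d M N → ((a * b * (c * d)) ^ M) ^ N ≡
            (a ^ N) ^ M * (b ^ M) ^ N * ((c ^ N) ^ M * (d ^ M) ^ N)
    right a b c d M N = trans (split (a * b) (c * d) M N) (cong₂ _*_
      (trans (split a b M N) (cong (_* (b ^ M) ^ N) (^-comm a M N)))
      (trans (split c d M N) (cong (_* (d ^ M) ^ N) (^-comm c M N))))

  -- The approximations are at most g(1), and (1 + K/N)(1 + 1/M) ≤ 1 + (1 + 2K)/t whenever t ≤ M and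
  -- t ≤ N. So two of them differ by at most `error` / t.
  error : ℕ
  error = g 1 * (1 + (K + K))

  close : ∀ m n t → t ≤ suc m → t ≤ suc n →
          num n * (den m * t) ≤ (num m * t + error * den m) * den n
  close m n t t≤M t≤N = *-cancelʳ-≤ _ _ (N * M) {{m*n≢0 N M}} (begin
    num n * (den m * t) * (N * M)
      ≡⟨ pull (num n) (den m) t (N * M) ⟩
    num n * den m * (N * M) * t
      ≤⟨ *-monoˡ-≤ t (ratio m n) ⟩
    (N + K) * (M + 1) * (num m * den n) * t
      ≡⟨ expand N M K (num m) (den n) t ⟩
    num m * t * den n * (N * M) + num m * den n * (t * N + K * (t * M) + K * t)
      ≤⟨ +-monoʳ-≤ (num m * t * den n * (N * M)) (*-mono-≤ (*-monoˡ-≤ (den n) (num≤den m))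
           (+-mono-≤ (+-mono-≤ tN≤ (*-monoʳ-≤ K (*-monoˡ-≤ M t≤N)))
             (*-monoʳ-≤ K (≤-trans t≤N (m≤m*n N M))))) ⟩
    num m * t * den n * (N * M) + g 1 * den m * den n * (N * M + K * (N * M) + K * (N * M))
      ≡⟨ collect (num m) t (den n) (N * M) (g 1) (den m) K ⟩
    (num m * t + error * den m) * den n * (N * M) ∎)
    where
    M = suc m
    N = suc n

    tN≤ : t * N ≤ N * M
    tN≤ = ≤-trans (*-monoˡ-≤ N t≤M) (≤-reflexive (*-comm M N))

    pull : ∀ a b t x → a * (b * t) * x ≡ a * b * x * t
    pull = solve-∀

    expand : ∀ N M K a d t → (N + K) * (M + 1) * (a * d) * t ≡
             a * t * d * (N * M) + a * d * (t * N + K * (t * M) + K * t)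
    expand = solve-∀

    collect : ∀ a t d x g e K → a * t * d * x + g * e * d * (x + K * x + K * x) ≡
              (a * t + g * (1 + (K + K)) * e) * d * x
    collect = solve-∀

  growthRate : ℝ
  growthRate = mkℝ (λ m → frac (num m) (den m)) λ ε 0<ε →
    let t , e/t≤ε = archimedean error ε 0<ε in
    suc t , λ m n t≤m t≤n → ℚ.≤-trans
      (∣p-q∣≤r (frac-≤-+ (num m) (num n) error (den m) (den n) (suc t) (close n m (suc t) (m≤n⇒m≤1+n t≤n) (m≤n⇒m≤1+n t≤m)))
               (frac-≤-+ (num n) (num m) error (den n) (den m) (suc t) (close m n (suc t) (m≤n⇒m≤1+n t≤m) (m≤n⇒m≤1+n t≤n))))
      e/t≤ε

  seq-growthRate-^ : ∀ n m → seq (growthRate ^ℝ n) m ≡ frac (num m ^ n) (den m ^ n) {{m^n≢0 (den m) n}}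
  seq-growthRate-^ zero    m = refl
  seq-growthRate-^ (suc n) m = trans (cong (frac (num m) (den m) ℚ.*_) (seq-growthRate-^ n m))
    (frac-* (num m) (num m ^ n) (den m) (den m ^ n) {{_}} {{m^n≢0 (den m) n}})

  -- The bounds `lower` and `upper` compare the power n + 1 with g(n + 1), whereas u(n + 1) is g(n).
  -- This shift costs a factor g(1) on one side and K on the other, whence the constants 1/(K g(1))
  -- and 2K².
  Θ-growthRate : ∀ (u : ℕ → ℕ) → (∀ n → u (suc n) ≡ g n) →
                 (λ n → fromℕ (u n)) =Θ (λ n → growthRate ^ℝ n)
  Θ-growthRate u u≡g =
    fromℚ (frac 1 (K * g 1) {{c≢0}}) , fromℕ (2 * K * K) ,
    (frac 1 (K * g 1) {{c≢0}} , pos 1 (K * g 1) {{c≢0}} ≤-refl , 0 , λ _ _ → ℚ.≤-reflexive (ℚ.+-identityˡ _)) ,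
    (frac (2 * K * K) 1 , pos (2 * K * K) 1 (≤-trans K>0 (m≤n*m K (2 * K) {{m*n≢0 2 K}})) , 0 , λ _ _ → ℚ.≤-reflexive (ℚ.+-identityˡ _)) ,
    1 , λ { (suc n) _ → below n , above n }
    where
    c≢0 : NonZero (K * g 1)
    c≢0 = m*n≢0 K (g 1)

    pos : ∀ a d .{{_ : NonZero d}} → 1 ≤ a → 0ℚ ℚ.< frac a d
    pos (suc a) d _ = ℚ.positive⁻¹ (frac (suc a) d) {{ℚ.normalize-pos (suc a) d}}

    below : ∀ n → fromℚ (frac 1 (K * g 1) {{c≢0}}) *ℝ growthRate ^ℝ suc n ≤ℝ fromℕ (u (suc n))
    below n ε 0<ε = suc n , λ m n<m → p≤q⇒p≤q+ε 0<ε (subst₂ ℚ._≤_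
      (sym (trans (cong (frac 1 (K * g 1) {{c≢0}} ℚ.*_) (seq-growthRate-^ (suc n) m))
        (frac-* 1 (num m ^ suc n) (K * g 1) (den m ^ suc n) {{c≢0}} {{m^n≢0 (den m) (suc n)}})))
      (cong (λ x → frac x 1) (sym (u≡g n)))
      (frac-≤ (1 * num m ^ suc n) (g n) (K * g 1 * den m ^ suc n) 1 {{m*n≢0 (K * g 1) (den m ^ suc n) {{c≢0}} {{m^n≢0 (den m) (suc n)}}}} (begin
        1 * num m ^ suc n * 1                   ≡⟨ trans (*-identityʳ _) (*-identityˡ _) ⟩
        num m ^ suc n                           ≤⟨ lower (suc n) m (m≤n⇒m≤1+n n<m) ⟩
        K * g (suc n) * den m ^ suc n           ≤⟨ *-monoˡ-≤ _ (*-monoʳ-≤ K (submult 1 n)) ⟩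
        K * (g 1 * g n) * den m ^ suc n         ≡⟨ rotate K (g 1) (g n) _ ⟩
        g n * (K * g 1 * den m ^ suc n)         ∎)))
      where
      rotate : ∀ a b c d → a * (b * c) * d ≡ c * (a * b * d)
      rotate = solve-∀

    above : ∀ n → fromℕ (u (suc n)) ≤ℝ fromℕ (2 * K * K) *ℝ growthRate ^ℝ suc n
    above n ε 0<ε = suc n , λ m n<m → p≤q⇒p≤q+ε 0<ε (subst₂ ℚ._≤_
      (cong (λ x → frac x 1) (sym (u≡g n)))
      (sym (trans (cong (frac (2 * K * K) 1 ℚ.*_) (seq-growthRate-^ (suc n) m))
        (frac-* (2 * K * K) (num m ^ suc n) 1 (den m ^ suc n) {{_}} {{m^n≢0 (den m) (suc n)}})))
      (frac-≤ (g n) (2 * K * K * num m ^ suc n) 1 (1 * den m ^ suc n) {{_}} {{m*n≢0 1 (den m ^ suc n) {{_}} {{m^n≢0 (den m) (suc n)}}}} (begin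
        g n * (1 * den m ^ suc n)               ≡⟨ cong (g n *_) (*-identityˡ _) ⟩
        g n * den m ^ suc n                     ≤⟨ *-monoˡ-≤ _ (m≤n*m (g n) (g 1)) ⟩
        g 1 * g n * den m ^ suc n               ≤⟨ *-monoˡ-≤ _ (supermult 1 n) ⟩
        g (suc n) * K * den m ^ suc n           ≡⟨ rotate (g (suc n)) K _ ⟩
        K * (g (suc n) * den m ^ suc n)         ≤⟨ *-monoʳ-≤ K (upper (suc n) m (m≤n⇒m≤1+n n<m)) ⟩
        K * (2 * K * num m ^ suc n)             ≡⟨ collect K _ ⟩
        2 * K * K * num m ^ suc n * 1           ∎)))
      where
      rotate : ∀ a b c → a * b * c ≡ b * (a * c)
      rotate = solve-∀

      collect : ∀ k x → k * (2 * k * x) ≡ 2 * k * k * x * 1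
      collect = solve-∀

-- Growth of the number of k-convex permutations

growth : ∀ {j} → let k = suc j in OneOrTwo k →
         ∃[ C ] (λ n → fromℕ (f k n)) =Θ (λ n → C ^ℝ n)
growth {j} k∈ =
  let K , supermult = words-supermultiplicative k∈
      open Quasimultiplicative (λ n → suc j [ [] ∣ n ]) K (words>0 j)
        ([∣]-zero [] tt) (words-submultiplicative (suc j)) supermult
  in growthRate , Θ-growthRate (f (suc j))
       (λ n → trans (f≡words (k≤2 k∈) n) (sym ([[]]≡count (suc j) n)))
  where
  k≤2 : ∀ {k} → OneOrTwo k → k ≤ 2
  k≤2 (inj₁ refl) = s≤s z≤n
  k≤2 (inj₂ refl) = ≤-refl

corollary3p13 : ∀ (k : ℕ) → k ≡ 1 ⊎ k ≡ 2 →
    ∃[ C ] (λ n → fromℕ (f k n)) =Θ (λ n → C ^ℝ n)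
corollary3p13 zero    (inj₁ ())
corollary3p13 zero    (inj₂ ())
corollary3p13 (suc j) k∈ = growth k∈
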